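{- If $\mathcal S=(\mathcal P,\mathcal L)$ is a finite thick generalized quadrangle and $G$ is an automorphism group of $\mathcal S$ acting primitively on $\mathcal P$, then the action of $G$ on $\mathcal P$ is not of O'Nan–Scott type HS.
   Context: A finite generalized quadrangle of order $(s,t)$ is a point-line incidence structure whose incidence graph is bipartite of diameter $4$ and girth $8$, with $s+1$ points per line and $t+1$ lines per point; thick means $s,t\ge2$. A primitive group $G$ has O'Nan–Scott type HS (holomorph simple) if $\mathrm{soc}(G)=T\times T$ for a nonabelian simple group $T$, the two factors $T\times1$ and $1\times T$ are minimal normal subgroups of $G$ acting regularly, and the stabilizer of a point in $\mathrm{soc}(G)$ is the diagonal subgroup $\{(x,x):x\in T\}$. -}

module Defs where

open import Level using (0ℓ)
open import Data.Nat using (ℕ; zero; suc; _+_; _≤_)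
open import Data.Bool using (Bool; true; false; if_then_else_)
open import Data.Fin using (Fin; zero; suc; inject₁; fromℕ)
open import Data.Vec using (Vec; lookup; tabulate; allFin)
open import Data.Product using (Σ; ∃; ∃-syntax; _×_; _,_; proj₁; proj₂)
open import Data.Sum using (_⊎_; inj₁; inj₂)
open import Data.Empty using (⊥)
open import Relation.Nullary using (¬_)
open import Relation.Binary.PropositionalEquality using (_≡_)
open import Relation.Binary.Structures using (IsEquivalence)
open import Algebra.Bundles using (Group)
open import Function using (_∘_; _⇔_)

count : ∀ {n} → (Fin n → Bool) → ℕ
count {zero}  f = 0
count {suc n} f = (if f zero then 1 else 0) + count (f ∘ suc)

module Graph {V : Set} (Adj : V → V → Set) where

  IsWalk : (k : ℕ) → (Fin (suc k) → V) → Set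
  IsWalk k w = (i : Fin k) → Adj (w (inject₁ i)) (w (suc i))

  WalkBetween : (k : ℕ) → V → V → Set
  WalkBetween k u v =
    Σ (Fin (suc k) → V) λ w → IsWalk k w × w zero ≡ u × w (fromℕ k) ≡ v

  DistLe : V → V → ℕ → Set
  DistLe u v d = ∃[ k ] (k ≤ d × WalkBetween k u v)

  HasDiameter : ℕ → Set
  HasDiameter d =
    (∀ u v → DistLe u v d) ×
    (Σ V λ u → Σ V λ v → ∀ k → WalkBetween k u v → d ≤ k)

  IsCycleOfLength : ℕ → Set
  IsCycleOfLength k =
    (3 ≤ k) ×
    (Σ (Fin (suc k) → V) λ w →
       IsWalk k w × w zero ≡ w (fromℕ k) ×
       (∀ (i j : Fin k) → w (inject₁ i) ≡ w (inject₁ j) → i ≡ j))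

  HasGirth : ℕ → Set
  HasGirth g = IsCycleOfLength g × (∀ k → IsCycleOfLength k → g ≤ k)

Incidence : ℕ → ℕ → Set
Incidence np nl = Fin np → Fin nl → Bool

IVertex : ℕ → ℕ → Set
IVertex np nl = Fin np ⊎ Fin nl

IAdj : ∀ {np nl} → Incidence np nl → IVertex np nl → IVertex np nl → Set
IAdj inc (inj₁ p) (inj₂ l) = inc p l ≡ true
IAdj inc (inj₂ l) (inj₁ p) = inc p l ≡ true
IAdj inc (inj₁ _) (inj₁ _) = ⊥
IAdj inc (inj₂ _) (inj₂ _) = ⊥

IsGQOfOrder : ∀ {np nl} → Incidence np nl → ℕ → ℕ → Set
IsGQOfOrder {np} {nl} inc s t =
  Graph.HasDiameter (IAdj inc) 4 ×
  Graph.HasGirth (IAdj inc) 8 ×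
  (∀ (l : Fin nl) → count (λ p → inc p l) ≡ suc s) ×
  (∀ (p : Fin np) → count (λ l → inc p l) ≡ suc t)

IsThickGQ : ∀ {np nl} → Incidence np nl → Set
IsThickGQ inc = ∃[ s ] ∃[ t ] (2 ≤ s × 2 ≤ t × IsGQOfOrder inc s t)

-- Maps of the structure: a pair (map on points, map on lines), stored as
-- vectors so that propositional equality is extensional equality.

PMap : ℕ → ℕ → Set
PMap np nl = Vec (Fin np) np × Vec (Fin nl) nl

pt : ∀ {np nl} → PMap np nl → Fin np → Fin np
pt g p = lookup (proj₁ g) p

ln : ∀ {np nl} → PMap np nl → Fin nl → Fin nl
ln g l = lookup (proj₂ g) l

_·_ : ∀ {np nl} → PMap np nl → PMap np nl → PMap np nl
g · h = tabulate (λ i → pt g (pt h i)) , tabulate (λ i → ln g (ln h i))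

e : ∀ {np nl} → PMap np nl
e {np} {nl} = allFin np , allFin nl

Injective : ∀ {n} → (Fin n → Fin n) → Set
Injective f = ∀ x y → f x ≡ f y → x ≡ y

-- automorphism: bijective on points and on lines (injective suffices on a
-- finite set) and preserving incidence and non-incidence
IsAut : ∀ {np nl} → Incidence np nl → PMap np nl → Set
IsAut inc g =
  Injective (pt g) × Injective (ln g) ×
  (∀ p l → inc (pt g p) (ln g l) ≡ inc p l)

Subset : ℕ → ℕ → Set
Subset np nl = PMap np nl → Bool

_∈ˢ_ : ∀ {np nl} → PMap np nl → Subset np nl → Set
x ∈ˢ H = H x ≡ true

_⊆ˢ_ : ∀ {np nl} → Subset np nl → Subset np nl → Set
H ⊆ˢ K = ∀ x → x ∈ˢ H → x ∈ˢ K

-- In a finite group of bijections, a nonempty subset closed under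
-- composition is a subgroup; we use "contains e and closed under ·".
IsSubgroup : ∀ {np nl} → Subset np nl → Set
IsSubgroup H = e ∈ˢ H × (∀ x y → x ∈ˢ H → y ∈ˢ H → (x · y) ∈ˢ H)

IsAutGroup : ∀ {np nl} → Incidence np nl → Subset np nl → Set
IsAutGroup inc G = IsSubgroup G × (∀ g → g ∈ˢ G → IsAut inc g)

-- N normal in G :  gN ⊆ Ng for all g ∈ G (equivalent to gN = Ng, finite)
IsNormalIn : ∀ {np nl} → Subset np nl → Subset np nl → Set
IsNormalIn G N =
  IsSubgroup N × N ⊆ˢ G ×
  (∀ g n → g ∈ˢ G → n ∈ˢ N → ∃[ n' ] (n' ∈ˢ N × g · n ≡ n' · g))

IsTrivial : ∀ {np nl} → Subset np nl → Set
IsTrivial N = ∀ x → x ∈ˢ N → x ≡ e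

IsMinimalNormal : ∀ {np nl} → Subset np nl → Subset np nl → Set
IsMinimalNormal G N =
  IsNormalIn G N × ¬ IsTrivial N ×
  (∀ M → IsNormalIn G M → M ⊆ˢ N → IsTrivial M ⊎ N ⊆ˢ M)

InSocle : ∀ {np nl} → Subset np nl → PMap np nl → Set
InSocle G x =
  ∀ H → IsSubgroup H → (∀ N → IsMinimalNormal G N → N ⊆ˢ H) → x ∈ˢ H

IsTransitive : ∀ {np nl} → Subset np nl → Set
IsTransitive {np} G = ∀ (p q : Fin np) → ∃[ g ] (g ∈ˢ G × pt g p ≡ q)

IsRegular : ∀ {np nl} → Subset np nl → Set
IsRegular {np} N =
  IsTransitive N ×
  (∀ n m (p : Fin np) → n ∈ˢ N → m ∈ˢ N → pt n p ≡ pt m p → n ≡ m)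

IsPrimitive : ∀ {np nl} → Subset np nl → Set₁
IsPrimitive {np} G =
  IsTransitive G ×
  (∀ (R : Fin np → Fin np → Set) → IsEquivalence R →
     (∀ g p q → g ∈ˢ G → R p q → R (pt g p) (pt g q)) →
     (∀ p q → R p q → p ≡ q) ⊎ (∀ p q → R p q))

module _ (T : Group 0ℓ 0ℓ) where
  open Group T

  IsNormalSubgroupOf : (Carrier → Set) → Set
  IsNormalSubgroupOf N =
    (∀ {x y} → x ≈ y → N x → N y) × N ε ×
    (∀ x y → N x → N y → N (x ∙ y)) × (∀ x → N x → N (x ⁻¹)) ×
    (∀ g x → N x → N ((g ∙ x) ∙ g ⁻¹))

  IsSimpleGroup : Set₁
  IsSimpleGroup =
    (∃[ x ] ¬ (x ≈ ε)) ×
    (∀ N → IsNormalSubgroupOf N → (∀ x → N x → x ≈ ε) ⊎ (∀ x → N x))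

  IsNonAbelian : Set
  IsNonAbelian = ∃[ x ] ∃[ y ] ¬ ((x ∙ y) ≈ (y ∙ x))

IsTypeHS : ∀ {np nl} → Subset np nl → Set₁
IsTypeHS {np} {nl} G =
  Σ (Group 0ℓ 0ℓ) λ T → let open Group T in
  IsNonAbelian T × IsSimpleGroup T ×
  Σ (Carrier × Carrier → PMap np nl) λ φ →
  Σ (Subset np nl) λ N₁ → Σ (Subset np nl) λ N₂ →
    (∀ a b c d → a ≈ c → b ≈ d → φ (a , b) ≡ φ (c , d)) ×
    (∀ a b c d → φ (a ∙ c , b ∙ d) ≡ φ (a , b) · φ (c , d)) ×
    (∀ a b c d → φ (a , b) ≡ φ (c , d) → a ≈ c × b ≈ d) ×
    (∀ x → InSocle G x ⇔ (∃[ a ] ∃[ b ] φ (a , b) ≡ x)) ×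
    (∀ x → x ∈ˢ N₁ ⇔ (∃[ a ] φ (a , ε) ≡ x)) ×
    (∀ x → x ∈ˢ N₂ ⇔ (∃[ b ] φ (ε , b) ≡ x)) ×
    IsMinimalNormal G N₁ × IsMinimalNormal G N₂ ×
    IsRegular N₁ × IsRegular N₂ ×
    (Σ (Fin np) λ p → ∀ a b → (pt (φ (a , b)) p ≡ p) ⇔ (a ≈ b))

{-# OPTIONS --safe #-}
-- A regular factor of the socle identifies the points with a finite group T so that collinearity (x ⊥ y, equality
-- included) is invariant under left and right multiplication, hence also under inversion.  As there are no triangles,
-- each line through ε is then a subgroup, and T permutes these subgroups by conjugation.  For a line i through ε let
-- c count the other lines through ε that centralise i.  Absence of triangles forces an element of another line that
-- normalises i to centralise it, so the normaliser of i has order (s+1)(1+cs), whereas |T| = (s+1)(1+ts); and i acts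
-- semiregularly on the t−c lines that do not centralise it, so s+1 divides t−c.  With an inequality of Higman type
-- bounding t by about s², and i not normal as T is simple, this leaves only c = 1.  Then all classes of lines through ε
-- have the same size k with k(1+s) = 1+ts, and k divides t+1, so 1+ts divides s+t, which is impossible.
module Submission where

open import Defs
open import Level using (0ℓ)
open import Algebra.Bundles using (Group)
open import Algebra.Structures using (IsGroup)
import Algebra.Properties.Group as GroupProperties
open import Data.Bool using (Bool; true; false; if_then_else_)
open import Data.Bool.Properties using () renaming (_≟_ to _≟ᴮ_)
open import Data.Empty using (⊥-elim)
open import Data.Fin using (Fin; zero; suc; inject₁) renaming (_≟_ to _≟ᶠ_)
open import Data.Fin.Properties using (any?; all?; ¬∀⟶∃¬)
open import Data.Integer as ℤ using (ℤ; +_; 0ℤ; 1ℤ) renaming (_+_ to _⊕_; _*_ to _⊗_; _-_ to _⊖_)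
import Data.Integer.Properties as ℤ
open import Data.Integer.Tactic.RingSolver using () renaming (solve-∀ to solve-ℤ)
open import Data.Nat using (ℕ; zero; suc; _+_; _*_; _≤_; _<_; z≤n; s≤s; s≤s⁻¹; >-nonZero)
open import Data.Nat.Divisibility using (_∣_; _∣0; divides; ∣-refl; ∣m∣n⇒∣m+n; ∣m+n∣m⇒∣n; ∣⇒≤; n∣m*n)
open import Data.Nat.Properties
open import Data.Nat.Tactic.RingSolver using () renaming (solve-∀ to solve-ℕ)
open import Data.Product using (∃; ∃-syntax; _×_; _,_; proj₁; proj₂)
open import Data.Sum using (_⊎_; inj₁; inj₂)
open import Data.Sum.Properties using (inj₁-injective; inj₂-injective)
open import Data.Unit using (⊤; tt)
open import Data.Vec using (lookup; _∷_; [])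
open import Data.Vec.Properties using (lookup∘tabulate)
open import Function using (_∘_; _⇔_; Equivalence)
open import Relation.Binary.PropositionalEquality
  using (_≡_; _≢_; refl; sym; trans; cong; cong₂; subst; subst₂; isEquivalence; module ≡-Reasoning)
open import Relation.Nullary using (¬_; Dec; yes; no; does; contradiction; ¬?; _×-dec_; _⊎-dec_; _→-dec_)
open import Algebra.Properties.CommutativeMonoid.Sum +-0-commutativeMonoid
  using (sum; sum-cong-≗; sum-replicate-zero; ∑-distrib-+; ∑-comm)
import Algebra.Properties.Semiring.Sum ℤ.+-*-semiring as Σ

-- Counting decidable subsets of a finite set.

indicator : {P : Set} → Dec P → ℕ
indicator P? = if does P? then 1 else 0

indicator-yes : {P : Set} (P? : Dec P) → P → indicator P? ≡ 1
indicator-yes (yes _) _ = refl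
indicator-yes (no ¬p) p = contradiction p ¬p

indicator-no : {P : Set} (P? : Dec P) → ¬ P → indicator P? ≡ 0
indicator-no (yes p) ¬p = contradiction p ¬p
indicator-no (no _)  _  = refl

indicator-cong : {P Q : Set} (P? : Dec P) (Q? : Dec Q) → (P → Q) → (Q → P) →
                 indicator P? ≡ indicator Q?
indicator-cong (yes p) Q? f g = sym (indicator-yes Q? (f p))
indicator-cong (no ¬p) Q? f g = sym (indicator-no Q? (¬p ∘ g))

# : ∀ {n} {P : Fin n → Set} → (∀ i → Dec (P i)) → ℕ
# P? = sum (indicator ∘ P?)

count≡# : ∀ {n} (f : Fin n → Bool) → count f ≡ # (λ i → f i ≟ᴮ true)
count≡# {zero}  f = refl
count≡# {suc n} f = cong₂ _+_ (lemma (f zero)) (count≡# (f ∘ suc))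
  where
  lemma : ∀ b → (if b then 1 else 0) ≡ indicator (b ≟ᴮ true)
  lemma true  = refl
  lemma false = refl

module _ {n} {P Q : Fin n → Set} (P? : ∀ i → Dec (P i)) (Q? : ∀ i → Dec (Q i)) where

  #-cong : (∀ i → P i → Q i) → (∀ i → Q i → P i) → # P? ≡ # Q?
  #-cong f g = sum-cong-≗ (λ i → indicator-cong (P? i) (Q? i) (f i) (g i))

  #-split : # P? ≡ # (λ i → P? i ×-dec Q? i) + # (λ i → P? i ×-dec ¬? (Q? i))
  #-split = trans (sum-cong-≗ lemma) (∑-distrib-+ (indicator ∘ λ i → P? i ×-dec Q? i) _)
    where
    lemma : ∀ i → indicator (P? i) ≡ indicator (P? i ×-dec Q? i) + indicator (P? i ×-dec ¬? (Q? i))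
    lemma i with P? i | Q? i
    ... | yes _ | yes _ = refl
    ... | yes _ | no _  = refl
    ... | no _  | yes _ = refl
    ... | no _  | no _  = refl

module _ {n} {P : Fin n → Set} (P? : ∀ i → Dec (P i)) where

  #-none : (∀ i → ¬ P i) → # P? ≡ 0
  #-none ¬p = trans (sum-cong-≗ (λ i → indicator-no (P? i) (¬p i))) (sum-replicate-zero n)

#-singleton : ∀ {n} (i : Fin n) → # (_≟ᶠ i) ≡ 1
#-singleton {suc n} zero    = cong suc (#-none (λ (j : Fin n) → suc j ≟ᶠ zero) (λ _ ()))
#-singleton {suc n} (suc i) =
  trans (#-cong (λ j → suc j ≟ᶠ suc i) (_≟ᶠ i) (λ { _ refl → refl }) (λ { _ refl → refl })) (#-singleton i)

module _ {n} {P : Fin n → Set} (P? : ∀ i → Dec (P i)) where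

  #-unique : ∀ i → P i → (∀ j → P j → j ≡ i) → # P? ≡ 1
  #-unique i p uniq = trans (#-cong P? (_≟ᶠ i) uniq (λ { _ refl → p })) (#-singleton i)

  #-mono : {Q : Fin n → Set} (Q? : ∀ i → Dec (Q i)) → (∀ i → P i → Q i) → # P? ≤ # Q?
  #-mono Q? f = subst (# P? ≤_) (sym (#-split Q? P?))
    (subst (_≤ # (λ i → Q? i ×-dec P? i) + # (λ i → Q? i ×-dec ¬? (P? i)))
      (#-cong (λ i → Q? i ×-dec P? i) P? (λ _ → proj₂) (λ i p → f i p , p)) (m≤m+n _ _))

  #-remove : ∀ i → P i → # P? ≡ suc (# (λ j → P? j ×-dec ¬? (j ≟ᶠ i)))
  #-remove i p = trans (#-split P? (_≟ᶠ i)) (cong (_+ # (λ j → P? j ×-dec ¬? (j ≟ᶠ i)))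
    (trans (#-cong (λ j → P? j ×-dec (j ≟ᶠ i)) (_≟ᶠ i) (λ _ → proj₂) (λ { _ refl → p , refl })) (#-singleton i)))

  #-witness : 0 < # P? → ∃ P
  #-witness 0<# with any? P?
  ... | yes p = p
  ... | no ¬p = contradiction (subst (0 <_) (#-none P? (λ i p → ¬p (i , p))) 0<#) (λ ())

#-avoid : ∀ {n} {P : Fin n → Set} (P? : ∀ i → Dec (P i)) → 1 < # P? → ∀ j → ∃[ i ] (P i × i ≢ j)
#-avoid P? 1<# j with P? j
... | no ¬p = let i , p = #-witness P? (<⇒≤ 1<#) in i , p , λ { refl → ¬p p }
... | yes p = #-witness (λ i → P? i ×-dec ¬? (i ≟ᶠ j)) (s≤s⁻¹ (subst (1 <_) (#-remove P? j p) 1<#))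

#-avoid₂ : ∀ {n} {P : Fin n → Set} (P? : ∀ i → Dec (P i)) → 2 < # P? → ∀ j k →
           ∃[ i ] (P i × i ≢ j × i ≢ k)
#-avoid₂ P? 2<# j k with P? j
... | no ¬p = let i , p , i≢k = #-avoid P? (<⇒≤ 2<#) k in i , p , (λ { refl → ¬p p }) , i≢k
... | yes p = let i , (q , i≢j) , i≢k = #-avoid (λ i → P? i ×-dec ¬? (i ≟ᶠ j))
                                          (s≤s⁻¹ (subst (2 <_) (#-remove P? j p) 2<#)) k
              in i , q , i≢j , i≢k

1<# : ∀ {n} {P : Fin n → Set} (P? : ∀ i → Dec (P i)) {i j} → P i → P j → i ≢ j → 1 < # P?
1<# P? {i} {j} p q i≢j = subst (1 <_) (sym (trans (#-remove P? i p)
  (cong suc (#-remove (λ k → P? k ×-dec ¬? (k ≟ᶠ i)) j (q , i≢j ∘ sym))))) (s≤s (s≤s z≤n))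

sum-supported : ∀ {n} {Q : Fin n → Set} (Q? : ∀ i → Dec (Q i)) (f : Fin n → ℕ) k →
  (∀ i → Q i → f i ≡ k) → (∀ i → ¬ Q i → f i ≡ 0) → sum f ≡ # Q? * k
sum-supported {zero}  Q? f k _ _ = refl
sum-supported {suc n} Q? f k on off with Q? zero
... | yes q = cong₂ _+_ (on zero q) (sum-supported (Q? ∘ suc) (f ∘ suc) k (on ∘ suc) (off ∘ suc))
... | no ¬q = cong₂ _+_ (off zero ¬q) (sum-supported (Q? ∘ suc) (f ∘ suc) k (on ∘ suc) (off ∘ suc))

module _ {m n} {P : Fin m → Set} {Q : Fin n → Set} {R : Fin m → Fin n → Set}
         (P? : ∀ i → Dec (P i)) (Q? : ∀ j → Dec (Q j)) (R? : ∀ i j → Dec (R i j)) where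

  #-fibres : ∀ k → (∀ {i j} → R i j → P i × Q j) →
             (∀ i → P i → ∃[ j ] (R i j × (∀ j′ → R i j′ → j′ ≡ j))) →
             (∀ j → Q j → # (λ i → R? i j) ≡ k) →
             # P? ≡ # Q? * k
  #-fibres k R⇒PQ fun fibre = begin
    -- Double count of the pairs in `R`, which is the graph of a function from `P` to `Q` with
    -- fibres of size `k`. Since `R` forces both `P` and `Q`, the sums may run over all indices.
    # P?                                        ≡⟨ sum-cong-≗ point ⟩
    sum (λ i → sum (λ j → indicator (R? i j)))  ≡⟨ ∑-comm (λ i j → indicator (R? i j)) ⟩
    sum (λ j → # (λ i → R? i j))                ≡⟨ sum-supported Q? _ k fibre
                                                     (λ j ¬q → #-none (λ i → R? i j) (λ i → ¬q ∘ proj₂ ∘ R⇒PQ)) ⟩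
    # Q? * k                                    ∎
    where
    open ≡-Reasoning
    point : ∀ i → indicator (P? i) ≡ # (R? i)
    point i with P? i
    ... | yes p = let j , r , uniq = fun i p in sym (#-unique (R? i) j r uniq)
    ... | no ¬p = sym (#-none (R? i) (λ _ → ¬p ∘ proj₁ ∘ R⇒PQ))

#-bijection : ∀ {m n} {P : Fin m → Set} {Q : Fin n → Set} (P? : ∀ i → Dec (P i)) (Q? : ∀ j → Dec (Q j))
              (f : Fin m → Fin n) (g : Fin n → Fin m) →
              (∀ i → P i → Q (f i)) → (∀ j → Q j → P (g j)) →
              (∀ i → g (f i) ≡ i) → (∀ j → f (g j) ≡ j) → # P? ≡ # Q?
#-bijection P? Q? f g pq qp gf fg = trans
  (#-fibres P? Q? (λ i j → P? i ×-dec (j ≟ᶠ f i)) 1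
    (λ { {i} (p , refl) → p , pq i p })
    (λ i p → f i , (p , refl) , λ _ → proj₂)
    (λ j q → #-unique (λ i → P? i ×-dec (j ≟ᶠ f i)) (g j) (qp j q , sym (fg j))
       (λ { i (_ , refl) → sym (gf i) })))
  (*-identityʳ _)

-- The classes of an equivalence relation on X are removed one at a time; b bounds the number of points left.
#-classes : ∀ {n} {X : Fin n → Set} {R : Fin n → Fin n → Set}
            (X? : ∀ i → Dec (X i)) (R? : ∀ i j → Dec (R i j)) k →
            (∀ i → X i → R i i) → (∀ i j → R i j → R j i) → (∀ i j l → R i j → R j l → R i l) →
            (∀ i j → X i → R i j → X j) → (∀ i → X i → # (R? i) ≡ k) →
            k ∣ # X?
#-classes {n} {R = R} X? R? k rfl symm trns closed size = go _ X? ≤-refl rfl closed size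
  where
  go : ∀ b {X : Fin n → Set} (X? : ∀ i → Dec (X i)) → # X? ≤ b →
       (∀ i → X i → R i i) → (∀ i j → X i → R i j → X j) → (∀ i → X i → # (R? i) ≡ k) → k ∣ # X?
  go b X? #X≤b rfl closed size with any? X?
  ... | no ¬x = subst (k ∣_) (sym (#-none X? (λ i x → ¬x (i , x)))) (k ∣0)
  go zero X? #X≤0 rfl closed size | yes (i , x) =
    contradiction (subst (_≤ 0) (#-remove X? i x) #X≤0) λ ()
  go (suc b) {X} X? #X≤b rfl closed size | yes (i , x) =
    subst (k ∣_) (sym split) (∣m∣n⇒∣m+n ∣-refl (go b X′? #X′≤b
      (λ j → rfl j ∘ proj₁)
      -- What is left after removing the class of `i` is again a union of classes: if `l` were in
      -- the class of `i`, so would be `j`.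
      (λ j l (xj , ¬ij) jl → closed j l xj jl , λ il → ¬ij (trns i l j il (symm j l jl)))
      (λ j → size j ∘ proj₁)))
    where
    X′? : ∀ j → Dec (X j × ¬ R i j)
    X′? j = X? j ×-dec ¬? (R? i j)
    split : # X? ≡ k + # X′?
    split = trans (#-split X? (R? i)) (cong (_+ # X′?)
      (trans (#-cong (λ j → X? j ×-dec R? i j) (R? i) (λ _ → proj₂) (λ j r → closed i j x r , r)) (size i x)))
    -- Each class contains its representative, so removing one lowers the bound `b`.
    0<k : 0 < k
    0<k = subst (0 <_) (trans (sym (#-remove (R? i) i (rfl i x))) (size i x)) (s≤s z≤n)
    #X′≤b : # X′? ≤ b
    #X′≤b = s≤s⁻¹ (≤-trans (≤-trans (+-monoˡ-≤ (# X′?) 0<k) (≤-reflexive (sym split))) #X≤b)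

-- Quadrangle axioms from girth and diameter.

module Geometry {np nl} (inc : Incidence np nl) where

  _∈_ : Fin np → Fin nl → Set
  x ∈ l = inc x l ≡ true

  _∈?_ : ∀ x l → Dec (x ∈ l)
  x ∈? l = inc x l ≟ᴮ true

  infix 4 _∈_ _∈?_ _⊥_ _⊥?_

  _⊥_ : Fin np → Fin np → Set
  x ⊥ y = ∃[ l ] (x ∈ l × y ∈ l)

  _⊥?_ : ∀ x y → Dec (x ⊥ y)
  x ⊥? y = any? (λ l → (x ∈? l) ×-dec (y ∈? l))

  ⊥-sym : ∀ {x y} → x ⊥ y → y ⊥ x
  ⊥-sym (l , xl , yl) = l , yl , xl

  module Axioms (diameter : Graph.HasDiameter (IAdj inc) 4) (girth : Graph.HasGirth (IAdj inc) 8) where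

    -- Otherwise `x`, `l`, `y`, `m` would form a 4-cycle in the incidence graph, against girth 8.
    line-unique : ∀ {x y l m} → x ≢ y → x ∈ l → y ∈ l → x ∈ m → y ∈ m → l ≡ m
    line-unique {x} {y} {l} {m} x≢y xl yl xm ym with l ≟ᶠ m
    ... | yes l≡m = l≡m
    ... | no l≢m = contradiction (proj₂ girth 4 (s≤s (s≤s (s≤s z≤n)) , lookup w , walk , refl , distinct))
                     λ { (s≤s (s≤s (s≤s (s≤s ())))) }
      where
      w = inj₁ x ∷ inj₂ l ∷ inj₁ y ∷ inj₂ m ∷ inj₁ x ∷ []
      walk : Graph.IsWalk (IAdj inc) 4 (lookup w)
      walk zero = xl
      walk (suc zero) = yl
      walk (suc (suc zero)) = ym
      walk (suc (suc (suc zero))) = xm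
      distinct : ∀ (i j : Fin 4) → lookup w (inject₁ i) ≡ lookup w (inject₁ j) → i ≡ j
      distinct zero zero _ = refl
      distinct zero (suc (suc zero)) eq = contradiction (inj₁-injective eq) x≢y
      distinct zero (suc (suc (suc zero))) ()
      distinct (suc zero) (suc zero) _ = refl
      distinct (suc zero) (suc (suc (suc zero))) eq = contradiction (inj₂-injective eq) l≢m
      distinct (suc (suc zero)) zero eq = contradiction (sym (inj₁-injective eq)) x≢y
      distinct (suc (suc zero)) (suc (suc zero)) _ = refl
      distinct (suc (suc zero)) (suc (suc (suc zero))) ()
      distinct (suc (suc (suc zero))) (suc zero) eq = contradiction (sym (inj₂-injective eq)) l≢m
      distinct (suc (suc (suc zero))) (suc (suc (suc zero))) _ = refl

    -- If `z` were off `l`, then `x`, `y`, `z` and the three joining lines would form a 6-cycle. As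
    -- `⊥` includes equality, the cases where `z` is `x` or `y` are covered as well.
    no-triangle : ∀ {x y z l} → x ≢ y → x ∈ l → y ∈ l → z ⊥ x → z ⊥ y → z ∈ l
    no-triangle {x} {y} {z} {l} x≢y xl yl (m , zm , xm) (k , zk , yk) with z ∈? l
    ... | yes zl = zl
    ... | no ¬zl = contradiction (proj₂ girth 6 (s≤s (s≤s (s≤s z≤n)) , lookup w , walk , refl , distinct))
                     λ { (s≤s (s≤s (s≤s (s≤s (s≤s (s≤s ())))))) }
      where
      w = inj₁ x ∷ inj₂ l ∷ inj₁ y ∷ inj₂ k ∷ inj₁ z ∷ inj₂ m ∷ inj₁ x ∷ []
      walk : Graph.IsWalk (IAdj inc) 6 (lookup w)
      walk zero = xl
      walk (suc zero) = yl
      walk (suc (suc zero)) = yk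
      walk (suc (suc (suc zero))) = zk
      walk (suc (suc (suc (suc zero)))) = zm
      walk (suc (suc (suc (suc (suc zero))))) = xm
      x≢z : x ≢ z
      x≢z refl = ¬zl xl
      y≢z : y ≢ z
      y≢z refl = ¬zl yl
      l≢k : l ≢ k
      l≢k refl = ¬zl zk
      l≢m : l ≢ m
      l≢m refl = ¬zl zm
      k≢m : k ≢ m
      k≢m refl = l≢m (line-unique x≢y xl yl xm yk)
      pattern 2F = suc (suc zero)
      pattern 3F = suc (suc (suc zero))
      pattern 4F = suc (suc (suc (suc zero)))
      pattern 5F = suc (suc (suc (suc (suc zero))))
      distinct : ∀ (i j : Fin 6) → lookup w (inject₁ i) ≡ lookup w (inject₁ j) → i ≡ j
      distinct zero zero _ = refl
      distinct zero 2F eq = contradiction (inj₁-injective eq) x≢y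
      distinct zero 4F eq = contradiction (inj₁-injective eq) x≢z
      distinct zero 5F ()
      distinct (suc zero) (suc zero) _ = refl
      distinct (suc zero) 3F eq = contradiction (inj₂-injective eq) l≢k
      distinct (suc zero) 5F eq = contradiction (inj₂-injective eq) l≢m
      distinct 2F zero eq = contradiction (sym (inj₁-injective eq)) x≢y
      distinct 2F 2F _ = refl
      distinct 2F 4F eq = contradiction (inj₁-injective eq) y≢z
      distinct 2F 5F ()
      distinct 3F (suc zero) eq = contradiction (sym (inj₂-injective eq)) l≢k
      distinct 3F 3F _ = refl
      distinct 3F 5F eq = contradiction (inj₂-injective eq) k≢m
      distinct 4F zero eq = contradiction (sym (inj₁-injective eq)) x≢z
      distinct 4F 2F eq = contradiction (sym (inj₁-injective eq)) y≢z
      distinct 4F 4F _ = refl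
      distinct 4F 5F ()
      distinct 5F (suc zero) eq = contradiction (sym (inj₂-injective eq)) l≢m
      distinct 5F 3F eq = contradiction (sym (inj₂-injective eq)) k≢m
      distinct 5F 5F _ = refl

    -- The diameter gives a walk of length at most 4, and a walk from a point to a line has odd
    -- length. Length 1 means that `x` is on `l`; a walk of length 3 passes through the wanted `y`.
    projection : ∀ x l → ∃[ y ] (y ∈ l × x ⊥ y)
    projection x l with proj₁ diameter (inj₁ x) (inj₂ l)
    ... | 0 , _ , w , _ , w₀ , w₁ = contradiction (trans (sym w₀) w₁) λ ()
    ... | 1 , _ , w , adj , w₀ , w₁ = near w₀ w₁ (adj zero)
      where
      near : ∀ {u v} → u ≡ inj₁ x → v ≡ inj₂ l → IAdj inc u v → ∃[ y ] (y ∈ l × x ⊥ y)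
      near refl refl xl = x , xl , l , xl , xl
    ... | 2 , _ , w , adj , w₀ , w₂ = ⊥-elim (odd {v = w (suc zero)} w₀ w₂ (adj zero) (adj (suc zero)))
      where
      odd : ∀ {u v z} → u ≡ inj₁ x → z ≡ inj₂ l → IAdj inc u v → ¬ IAdj inc v z
      odd {v = inj₁ _} refl refl () _
      odd {v = inj₂ _} refl refl _ ()
    ... | 3 , _ , w , adj , w₀ , w₃ =
      far {v = w (suc zero)} {z = w (suc (suc zero))} w₀ w₃ (adj zero) (adj (suc zero)) (adj (suc (suc zero)))
      where
      far : ∀ {u v z t} → u ≡ inj₁ x → t ≡ inj₂ l → IAdj inc u v → IAdj inc v z → IAdj inc z t →
            ∃[ y ] (y ∈ l × x ⊥ y)
      far {v = inj₂ m} {inj₁ y} refl refl xm ym yl = y , yl , m , xm , ym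
    ... | 4 , _ , w , adj , w₀ , w₄ =
      ⊥-elim (odd {v = w (suc zero)} {w (suc (suc zero))} {w (suc (suc (suc zero)))} w₀ w₄
                  (adj zero) (adj (suc zero)) (adj (suc (suc zero))) (adj (suc (suc (suc zero)))))
      where
      odd : ∀ {u v z t r} → u ≡ inj₁ x → r ≡ inj₂ l → IAdj inc u v → IAdj inc v z → IAdj inc z t → ¬ IAdj inc t r
      odd {v = inj₂ _} {inj₁ _} {inj₂ _} refl refl _ _ _ ()
    ... | suc (suc (suc (suc (suc _)))) , s≤s (s≤s (s≤s (s≤s ()))) , _

-- Point counts in a quadrangle of order (s,t).

#-all : ∀ n → # {n} (λ _ → yes tt) ≡ n
#-all zero = refl
#-all (suc n) = cong suc (#-all n)

sum-nonneg : ∀ {n} (f : Fin n → ℤ) → (∀ i → 0ℤ ℤ.≤ f i) → 0ℤ ℤ.≤ Σ.sum f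
sum-nonneg {zero}  f 0≤f = ℤ.≤-refl
sum-nonneg {suc n} f 0≤f = ℤ.+-mono-≤ (0≤f zero) (sum-nonneg (f ∘ suc) (0≤f ∘ suc))

square-nonneg : ∀ i → 0ℤ ℤ.≤ i ℤ.* i
square-nonneg (+ zero)  = ℤ.≤-refl
square-nonneg (+ suc n) = ℤ.+≤+ z≤n
square-nonneg (ℤ.-[1+ n ]) = ℤ.+≤+ z≤n

module Quadrangle {np nl s t} (inc : Incidence np nl) (gq : IsGQOfOrder inc s t) where

  open Geometry inc public
  open Axioms (proj₁ gq) (proj₁ (proj₂ gq)) public

  #line : ∀ l → # (_∈? l) ≡ suc s
  #line l = trans (sym (count≡# (λ p → inc p l))) (proj₁ (proj₂ (proj₂ gq)) l)

  #pencil : ∀ x → # (x ∈?_) ≡ suc t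
  #pencil x = trans (sym (count≡# (inc x))) (proj₂ (proj₂ (proj₂ gq)) x)

  line-through : ∀ x → ∃[ l ] (x ∈ l)
  line-through x = #-witness (x ∈?_) (subst (0 <_) (sym (#pencil x)) (s≤s z≤n))

  ⊥-refl : ∀ x → x ⊥ x
  ⊥-refl x = let l , xl = line-through x in l , xl , xl

  #⊥ : ∀ x → # (x ⊥?_) ≡ 1 + suc t * s
  #⊥ x = trans (#-remove (x ⊥?_) x (⊥-refl x)) (cong suc
    (trans (#-fibres (λ z → (x ⊥? z) ×-dec ¬? (z ≟ᶠ x)) (x ∈?_)
              (λ z l → (x ∈? l) ×-dec ((z ∈? l) ×-dec ¬? (z ≟ᶠ x))) s
              (λ { {_} {l} (xl , zl , z≢x) → ((l , xl , zl) , z≢x) , xl })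
              (λ { z ((l , xl , zl) , z≢x) → l , (xl , zl , z≢x) ,
                   λ { m (xm , zm , _) → line-unique z≢x zm xm zl xl } })
              (λ l xl → trans (#-cong (λ z → (x ∈? l) ×-dec ((z ∈? l) ×-dec ¬? (z ≟ᶠ x)))
                                 (λ z → (z ∈? l) ×-dec ¬? (z ≟ᶠ x)) (λ _ → proj₂) (λ _ → xl ,_))
                          (suc-injective (trans (sym (#-remove (_∈? l) x xl)) (#line l)))))
      (cong (_* s) (#pencil x))))

  #⊥⊥-collinear : ∀ {x y} → x ≢ y → x ⊥ y → # (λ z → (x ⊥? z) ×-dec (y ⊥? z)) ≡ suc s
  #⊥⊥-collinear {x} {y} x≢y (l , xl , yl) = trans
    (#-cong (λ z → (x ⊥? z) ×-dec (y ⊥? z)) (_∈? l)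
      (λ z (xz , yz) → no-triangle x≢y xl yl (⊥-sym xz) (⊥-sym yz))
      (λ z zl → (l , xl , zl) , (l , yl , zl)))
    (#line l)

  -- Each of the t + 1 lines through `x` carries exactly one point collinear with `y`: two would put
  -- `y` on that line, making it collinear with `x`.
  #⊥⊥-noncollinear : ∀ {x y} → ¬ x ⊥ y → # (λ z → (x ⊥? z) ×-dec (y ⊥? z)) ≡ suc t
  #⊥⊥-noncollinear {x} {y} x≁y = trans
    (trans (#-fibres (λ z → (x ⊥? z) ×-dec (y ⊥? z)) (x ∈?_)
             (λ z l → (x ∈? l) ×-dec ((z ∈? l) ×-dec (y ⊥? z))) 1
             (λ { {_} {l} (xl , zl , yz) → ((l , xl , zl) , yz) , xl })
             (λ { z ((l , xl , zl) , yz) → l , (xl , zl , yz) ,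
                  λ { m (xm , zm , _) → line-unique (λ { refl → x≁y (⊥-sym yz) }) xm zm xl zl } })
             (λ l xl → let z , zl , yz = projection y l in
                #-unique (λ z → (x ∈? l) ×-dec ((z ∈? l) ×-dec (y ⊥? z))) z (xl , zl , yz) (unique xl zl yz)))
           (*-identityʳ _))
    (#pencil x)
    where
    unique : ∀ {l z} → x ∈ l → z ∈ l → y ⊥ z → ∀ w → x ∈ l × w ∈ l × y ⊥ w → w ≡ z
    unique {l} {z} xl zl yz w (_ , wl , yw) with w ≟ᶠ z
    ... | yes w≡z = w≡z
    ... | no w≢z = contradiction (l , xl , no-triangle w≢z wl zl yw yz) x≁y

  -- Points off a fixed line `l` are sorted by their projection to `l`. A point of `l` is collinear
  -- with 1 + (t + 1)s points, itself included, of which s + 1 are on `l`; this leaves ts. A line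
  -- through the argument serves as `l`.
  #points : Fin np → np ≡ suc s * suc (t * s)
  #points x = begin
    np                                              ≡⟨ #-all np ⟨
    # point?                                          ≡⟨ #-split point? (_∈? l) ⟩
    # (λ z → yes tt ×-dec (z ∈? l)) + # off?        ≡⟨ cong₂ _+_ (trans (#-cong (λ z → yes tt ×-dec (z ∈? l)) (_∈? l) (λ _ → proj₂) (λ _ → tt ,_)) (#line l)) #off ⟩
    suc s + suc s * (t * s)                         ≡⟨ *-suc (suc s) (t * s) ⟨
    suc s * suc (t * s)                             ∎
    where
    open ≡-Reasoning
    l = proj₁ (line-through x)
    point? : Fin np → Dec ⊤
    point? _ = yes tt
    off? : ∀ z → Dec (⊤ × ¬ z ∈ l)
    off? z = point? z ×-dec ¬? (z ∈? l)
    fibre : ∀ y → y ∈ l → # (λ z → (y ∈? l) ×-dec (¬? (z ∈? l) ×-dec (y ⊥? z))) ≡ t * s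
    fibre y yl = +-cancelˡ-≡ (suc s) _ _ (begin
      suc s + # fib?                                        ≡⟨ cong₂ _+_ (trans (sym (#line l))
                                                                 (#-cong (_∈? l) on? (λ z zl → (l , yl , zl) , zl) (λ _ → proj₂)))
                                                                 (#-cong fib? off′? (λ z (_ , z∉ , yz) → yz , z∉) (λ z (yz , z∉) → yl , z∉ , yz)) ⟩
      # on? + # off′?                                       ≡⟨ #-split (y ⊥?_) (_∈? l) ⟨
      # (y ⊥?_)                                             ≡⟨ #⊥ y ⟩
      suc s + t * s                                         ∎)
      where
      fib? = λ z → (y ∈? l) ×-dec (¬? (z ∈? l) ×-dec (y ⊥? z))
      on? = λ z → (y ⊥? z) ×-dec (z ∈? l)
      off′? = λ z → (y ⊥? z) ×-dec ¬? (z ∈? l)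
    #off : # off? ≡ suc s * (t * s)
    #off = trans (#-fibres off? (_∈? l) (λ z y → (y ∈? l) ×-dec (¬? (z ∈? l) ×-dec (y ⊥? z))) (t * s)
                   (λ { (yl , z∉ , _) → (tt , z∉) , yl })
                   (λ { z (_ , z∉) → let y , yl , zy = projection z l in
                        y , (yl , z∉ , ⊥-sym zy) , unique z∉ yl zy })
                   fibre)
                 (cong (_* (t * s)) (#line l))
      where
      unique : ∀ {z y} → ¬ z ∈ l → y ∈ l → z ⊥ y → ∀ w → w ∈ l × ¬ z ∈ l × w ⊥ z → w ≡ y
      unique {z} {y} z∉ yl zy w (wl , _ , wz) with w ≟ᶠ y
      ... | yes w≡y = w≡y
      ... | no w≢y = contradiction (no-triangle w≢y wl yl (⊥-sym wz) zy) z∉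

-- Eigenspace projection and a Higman-type inequality.

indicatorᶻ : {P : Set} → Dec P → ℤ
indicatorᶻ P? = + indicator P?

sum-indicatorᶻ : ∀ {n} {P : Fin n → Set} (P? : ∀ i → Dec (P i)) → Σ.sum (indicatorᶻ ∘ P?) ≡ + # P?
sum-indicatorᶻ {zero}  P? = refl
sum-indicatorᶻ {suc n} P? = cong (indicatorᶻ (P? zero) ⊕_) (sum-indicatorᶻ (P? ∘ suc))

sum-δ : ∀ {n} (f : Fin n → ℤ) i → Σ.sum (λ j → indicatorᶻ (i ≟ᶠ j) ⊗ f j) ≡ f i
sum-δ {suc n} f zero = begin
  1ℤ ⊗ f zero ⊕ Σ.sum (λ j → 0ℤ ⊗ f (suc j))  ≡⟨ cong₂ _⊕_ (ℤ.*-identityˡ (f zero)) (trans (Σ.sum-cong-≗ (λ j → ℤ.*-zeroˡ (f (suc j)))) (Σ.sum-replicate-zero n)) ⟩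
  f zero ⊕ 0ℤ                                ≡⟨ ℤ.+-identityʳ (f zero) ⟩
  f zero                                     ∎
  where open ≡-Reasoning
sum-δ {suc n} f (suc i) = begin
  0ℤ ⊗ f zero ⊕ Σ.sum (λ j → indicatorᶻ (suc i ≟ᶠ suc j) ⊗ f (suc j))  ≡⟨ cong₂ _⊕_ (ℤ.*-zeroˡ (f zero)) (Σ.sum-cong-≗ (λ j → cong (λ k → + k ⊗ f (suc j)) (indicator-cong (suc i ≟ᶠ suc j) (i ≟ᶠ j) (λ { refl → refl }) (λ { refl → refl })))) ⟩
  0ℤ ⊕ Σ.sum (λ j → indicatorᶻ (i ≟ᶠ j) ⊗ f (suc j))                   ≡⟨ ℤ.+-identityˡ _ ⟩
  Σ.sum (λ j → indicatorᶻ (i ≟ᶠ j) ⊗ f (suc j))                        ≡⟨ sum-δ (f ∘ suc) i ⟩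
  f (suc i)                                                            ∎
  where open ≡-Reasoning

module Spectral {np nl s t} (inc : Incidence np nl) (gq : IsGQOfOrder inc s t) where

  open Quadrangle inc gq
  open ≡-Reasoning

  σ τ : ℤ
  σ = + s
  τ = + t

  -- `A` is the collinearity matrix with ones on the diagonal; its eigenvalues are 1 + (t + 1)s, s
  -- and -t. The coefficients of `ψ` are chosen to kill the first two eigenspaces and to act as `κ`
  -- on the third.
  A δ ψ : Fin np → Fin np → ℤ
  A x y = indicatorᶻ (x ⊥? y)
  δ x y = indicatorᶻ (x ≟ᶠ y)
  ψ x y = 1ℤ ⊕ ℤ.- (1ℤ ⊕ σ) ⊗ A x y ⊕ σ ⊗ (1ℤ ⊕ σ) ⊗ δ x y

  ⟨_,_⟩ : (Fin np → ℤ) → (Fin np → ℤ) → ℤ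
  ⟨ f , g ⟩ = Σ.sum (λ z → f z ⊗ g z)

  κ : ℤ
  κ = (1ℤ ⊕ σ) ⊗ (σ ⊕ τ)

  sum-A : ∀ x → Σ.sum (A x) ≡ 1ℤ ⊕ (1ℤ ⊕ τ) ⊗ σ
  sum-A x = trans (sum-indicatorᶻ (x ⊥?_)) (trans (cong +_ (#⊥ x)) (cong (1ℤ ⊕_) (ℤ.pos-* (suc t) s)))

  -- The strongly regular graph relation A² = (1 + t)J + (s - t)A + st I, read off entrywise in the
  -- three cases equal, collinear and noncollinear.
  ⟨A,A⟩ : ∀ x y → ⟨ A x , A y ⟩ ≡ 1ℤ ⊕ τ ⊕ (σ ⊖ τ) ⊗ A x y ⊕ σ ⊗ τ ⊗ δ x y
  ⟨A,A⟩ x y = trans (trans (Σ.sum-cong-≗ product) (sum-indicatorᶻ (λ z → (x ⊥? z) ×-dec (y ⊥? z)))) (cases (x ⊥? y) (x ≟ᶠ y))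
    where
    product : ∀ z → A x z ⊗ A y z ≡ indicatorᶻ ((x ⊥? z) ×-dec (y ⊥? z))
    product z with x ⊥? z | y ⊥? z
    ... | yes _ | yes _ = refl
    ... | yes _ | no _  = refl
    ... | no _  | yes _ = refl
    ... | no _  | no _  = refl
    cases : (x⊥?y : Dec (x ⊥ y)) (x≟y : Dec (x ≡ y)) → + # (λ z → (x ⊥? z) ×-dec (y ⊥? z)) ≡
            1ℤ ⊕ τ ⊕ (σ ⊖ τ) ⊗ indicatorᶻ x⊥?y ⊕ σ ⊗ τ ⊗ indicatorᶻ x≟y
    cases (yes _) (yes refl) = trans
      (cong +_ (#-cong (λ z → (x ⊥? z) ×-dec (x ⊥? z)) (x ⊥?_) (λ _ → proj₁) (λ _ p → p , p)))
      (trans (sum-A′) (poly σ τ))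
      where
      sum-A′ : + # (x ⊥?_) ≡ 1ℤ ⊕ (1ℤ ⊕ τ) ⊗ σ
      sum-A′ = trans (sym (sum-indicatorᶻ (x ⊥?_))) (sum-A x)
      poly : ∀ σ τ → 1ℤ ⊕ (1ℤ ⊕ τ) ⊗ σ ≡ 1ℤ ⊕ τ ⊕ (σ ⊖ τ) ⊗ 1ℤ ⊕ σ ⊗ τ ⊗ 1ℤ
      poly = solve-ℤ
    cases (yes x⊥y) (no x≢y) = trans (cong +_ (#⊥⊥-collinear x≢y x⊥y)) (poly σ τ)
      where
      poly : ∀ σ τ → 1ℤ ⊕ σ ≡ 1ℤ ⊕ τ ⊕ (σ ⊖ τ) ⊗ 1ℤ ⊕ σ ⊗ τ ⊗ 0ℤ
      poly = solve-ℤ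
    cases (no x≁y) (yes refl) = contradiction (⊥-refl x) x≁y
    cases (no x≁y) (no _) = trans (cong +_ (#⊥⊥-noncollinear x≁y)) (poly σ τ)
      where
      poly : ∀ σ τ → 1ℤ ⊕ τ ≡ 1ℤ ⊕ τ ⊕ (σ ⊖ τ) ⊗ 0ℤ ⊕ σ ⊗ τ ⊗ 0ℤ
      poly = solve-ℤ

  A-sym : ∀ x y → A x y ≡ A y x
  A-sym x y = cong +_ (indicator-cong (x ⊥? y) (y ⊥? x) ⊥-sym ⊥-sym)

  ψ-sym : ∀ x y → ψ x y ≡ ψ y x
  ψ-sym x y = cong₂ (λ a d → 1ℤ ⊕ ℤ.- (1ℤ ⊕ σ) ⊗ a ⊕ σ ⊗ (1ℤ ⊕ σ) ⊗ d) (A-sym x y)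
    (cong +_ (indicator-cong (x ≟ᶠ y) (y ≟ᶠ x) sym sym))

  ⟨⟩-comm : ∀ f g → ⟨ f , g ⟩ ≡ ⟨ g , f ⟩
  ⟨⟩-comm f g = Σ.sum-cong-≗ (λ z → ℤ.*-comm (f z) (g z))

  ⟨⟩-linear : ∀ a f b g h → ⟨ h , (λ z → a ⊗ f z ⊕ b ⊗ g z) ⟩ ≡ a ⊗ ⟨ h , f ⟩ ⊕ b ⊗ ⟨ h , g ⟩
  ⟨⟩-linear a f b g h = begin
    Σ.sum (λ z → h z ⊗ (a ⊗ f z ⊕ b ⊗ g z))                              ≡⟨ Σ.sum-cong-≗ (λ z → poly a b (f z) (g z) (h z)) ⟩
    Σ.sum (λ z → a ⊗ (h z ⊗ f z) ⊕ b ⊗ (h z ⊗ g z))                      ≡⟨ Σ.∑-distrib-+ (λ z → a ⊗ (h z ⊗ f z)) _ ⟩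
    Σ.sum (λ z → a ⊗ (h z ⊗ f z)) ⊕ Σ.sum (λ z → b ⊗ (h z ⊗ g z))        ≡⟨ cong₂ _⊕_ (Σ.*-distribˡ-sum a (λ z → h z ⊗ f z)) (Σ.*-distribˡ-sum b (λ z → h z ⊗ g z)) ⟨
    a ⊗ ⟨ h , f ⟩ ⊕ b ⊗ ⟨ h , g ⟩                                        ∎
    where
    poly : ∀ a b f g h → h ⊗ (a ⊗ f ⊕ b ⊗ g) ≡ a ⊗ (h ⊗ f) ⊕ b ⊗ (h ⊗ g)
    poly = solve-ℤ

  ⟨-,ψ⟩ : ∀ f x → ⟨ f , ψ x ⟩ ≡ Σ.sum f ⊕ ℤ.- (1ℤ ⊕ σ) ⊗ ⟨ f , A x ⟩ ⊕ σ ⊗ (1ℤ ⊕ σ) ⊗ f x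
  ⟨-,ψ⟩ f x = begin
    ⟨ f , ψ x ⟩
      ≡⟨ Σ.sum-cong-≗ (λ z → poly σ (f z) (A x z) (δ x z)) ⟩
    Σ.sum (λ z → f z ⊕ f z ⊗ (ℤ.- (1ℤ ⊕ σ) ⊗ A x z ⊕ σ ⊗ (1ℤ ⊕ σ) ⊗ δ x z))
      ≡⟨ Σ.∑-distrib-+ f _ ⟩
    Σ.sum f ⊕ ⟨ f , (λ z → ℤ.- (1ℤ ⊕ σ) ⊗ A x z ⊕ σ ⊗ (1ℤ ⊕ σ) ⊗ δ x z) ⟩
      ≡⟨ cong (Σ.sum f ⊕_) (⟨⟩-linear (ℤ.- (1ℤ ⊕ σ)) (A x) (σ ⊗ (1ℤ ⊕ σ)) (δ x) f) ⟩
    Σ.sum f ⊕ (ℤ.- (1ℤ ⊕ σ) ⊗ ⟨ f , A x ⟩ ⊕ σ ⊗ (1ℤ ⊕ σ) ⊗ ⟨ f , δ x ⟩)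
      ≡⟨ cong (λ d → Σ.sum f ⊕ (ℤ.- (1ℤ ⊕ σ) ⊗ ⟨ f , A x ⟩ ⊕ σ ⊗ (1ℤ ⊕ σ) ⊗ d)) (trans (⟨⟩-comm f (δ x)) (sum-δ f x)) ⟩
    Σ.sum f ⊕ (ℤ.- (1ℤ ⊕ σ) ⊗ ⟨ f , A x ⟩ ⊕ σ ⊗ (1ℤ ⊕ σ) ⊗ f x)
      ≡⟨ ℤ.+-assoc (Σ.sum f) _ _ ⟨
    Σ.sum f ⊕ ℤ.- (1ℤ ⊕ σ) ⊗ ⟨ f , A x ⟩ ⊕ σ ⊗ (1ℤ ⊕ σ) ⊗ f x ∎
    where
    poly : ∀ σ f a d → f ⊗ (1ℤ ⊕ ℤ.- (1ℤ ⊕ σ) ⊗ a ⊕ σ ⊗ (1ℤ ⊕ σ) ⊗ d) ≡ f ⊕ f ⊗ (ℤ.- (1ℤ ⊕ σ) ⊗ a ⊕ σ ⊗ (1ℤ ⊕ σ) ⊗ d)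
    poly = solve-ℤ

  sum-1 : Fin np → Σ.sum {np} (λ _ → 1ℤ) ≡ (1ℤ ⊕ σ) ⊗ (1ℤ ⊕ τ ⊗ σ)
  sum-1 x = trans (sum-indicatorᶻ (λ (_ : Fin np) → yes tt)) (trans (cong +_ (trans (#-all np) (#points x)))
    (trans (ℤ.pos-* (suc s) (suc (t * s))) (cong (λ k → (1ℤ ⊕ σ) ⊗ (1ℤ ⊕ k)) (ℤ.pos-* t s))))

  -- Orthogonality to the constants; in the Gram computation this removes the all-ones part of
  -- `ψ y`.
  sum-ψ : ∀ x → Σ.sum (ψ x) ≡ 0ℤ
  sum-ψ x = begin
    Σ.sum (ψ x)
      ≡⟨ Σ.sum-cong-≗ (λ z → ℤ.*-identityˡ (ψ x z)) ⟨
    ⟨ (λ _ → 1ℤ) , ψ x ⟩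
      ≡⟨ ⟨-,ψ⟩ (λ _ → 1ℤ) x ⟩
    Σ.sum {np} (λ _ → 1ℤ) ⊕ ℤ.- (1ℤ ⊕ σ) ⊗ ⟨ (λ _ → 1ℤ) , A x ⟩ ⊕ σ ⊗ (1ℤ ⊕ σ) ⊗ 1ℤ
      ≡⟨ cong₂ (λ a b → a ⊕ ℤ.- (1ℤ ⊕ σ) ⊗ b ⊕ σ ⊗ (1ℤ ⊕ σ) ⊗ 1ℤ) (sum-1 x)
           (trans (Σ.sum-cong-≗ (λ z → ℤ.*-identityˡ (A x z))) (sum-A x)) ⟩
    (1ℤ ⊕ σ) ⊗ (1ℤ ⊕ τ ⊗ σ) ⊕ ℤ.- (1ℤ ⊕ σ) ⊗ (1ℤ ⊕ (1ℤ ⊕ τ) ⊗ σ) ⊕ σ ⊗ (1ℤ ⊕ σ) ⊗ 1ℤ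
      ≡⟨ poly σ τ ⟩
    0ℤ ∎
    where
    poly : ∀ σ τ → (1ℤ ⊕ σ) ⊗ (1ℤ ⊕ τ ⊗ σ) ⊕ ℤ.- (1ℤ ⊕ σ) ⊗ (1ℤ ⊕ (1ℤ ⊕ τ) ⊗ σ) ⊕ σ ⊗ (1ℤ ⊕ σ) ⊗ 1ℤ ≡ 0ℤ
    poly = solve-ℤ

  -- Up to a scalar, ψ is the projection onto the eigenspace of the collinearity graph for the eigenvalue -t-1.
  ⟨ψ,ψ⟩ : ∀ x y → ⟨ ψ x , ψ y ⟩ ≡ κ ⊗ ψ x y
  ⟨ψ,ψ⟩ x y = begin
    ⟨ ψ x , ψ y ⟩
      ≡⟨ ⟨-,ψ⟩ (ψ x) y ⟩
    Σ.sum (ψ x) ⊕ ℤ.- (1ℤ ⊕ σ) ⊗ ⟨ ψ x , A y ⟩ ⊕ σ ⊗ (1ℤ ⊕ σ) ⊗ ψ x y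
      ≡⟨ cong₂ (λ a b → a ⊕ ℤ.- (1ℤ ⊕ σ) ⊗ b ⊕ σ ⊗ (1ℤ ⊕ σ) ⊗ ψ x y) (sum-ψ x)
           (trans (⟨⟩-comm (ψ x) (A y)) (⟨-,ψ⟩ (A y) x)) ⟩
    0ℤ ⊕ ℤ.- (1ℤ ⊕ σ) ⊗ (Σ.sum (A y) ⊕ ℤ.- (1ℤ ⊕ σ) ⊗ ⟨ A y , A x ⟩ ⊕ σ ⊗ (1ℤ ⊕ σ) ⊗ A y x) ⊕ σ ⊗ (1ℤ ⊕ σ) ⊗ ψ x y
      ≡⟨ cong₂ (λ a b → 0ℤ ⊕ ℤ.- (1ℤ ⊕ σ) ⊗ (a ⊕ ℤ.- (1ℤ ⊕ σ) ⊗ b ⊕ σ ⊗ (1ℤ ⊕ σ) ⊗ A y x) ⊕ σ ⊗ (1ℤ ⊕ σ) ⊗ ψ x y)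
           (sum-A y) (trans (⟨⟩-comm (A y) (A x)) (⟨A,A⟩ x y)) ⟩
    0ℤ ⊕ ℤ.- (1ℤ ⊕ σ) ⊗ (1ℤ ⊕ (1ℤ ⊕ τ) ⊗ σ ⊕ ℤ.- (1ℤ ⊕ σ) ⊗ (1ℤ ⊕ τ ⊕ (σ ⊖ τ) ⊗ A x y ⊕ σ ⊗ τ ⊗ δ x y) ⊕ σ ⊗ (1ℤ ⊕ σ) ⊗ A y x) ⊕ σ ⊗ (1ℤ ⊕ σ) ⊗ ψ x y
      ≡⟨ cong (λ a → 0ℤ ⊕ ℤ.- (1ℤ ⊕ σ) ⊗ (1ℤ ⊕ (1ℤ ⊕ τ) ⊗ σ ⊕ ℤ.- (1ℤ ⊕ σ) ⊗ (1ℤ ⊕ τ ⊕ (σ ⊖ τ) ⊗ A x y ⊕ σ ⊗ τ ⊗ δ x y) ⊕ σ ⊗ (1ℤ ⊕ σ) ⊗ a) ⊕ σ ⊗ (1ℤ ⊕ σ) ⊗ ψ x y) (A-sym y x) ⟩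
    0ℤ ⊕ ℤ.- (1ℤ ⊕ σ) ⊗ (1ℤ ⊕ (1ℤ ⊕ τ) ⊗ σ ⊕ ℤ.- (1ℤ ⊕ σ) ⊗ (1ℤ ⊕ τ ⊕ (σ ⊖ τ) ⊗ A x y ⊕ σ ⊗ τ ⊗ δ x y) ⊕ σ ⊗ (1ℤ ⊕ σ) ⊗ A x y) ⊕ σ ⊗ (1ℤ ⊕ σ) ⊗ ψ x y
      ≡⟨ poly σ τ (A x y) (δ x y) ⟩
    κ ⊗ ψ x y ∎
    where
    poly : ∀ σ τ a d →
      0ℤ ⊕ ℤ.- (1ℤ ⊕ σ) ⊗ (1ℤ ⊕ (1ℤ ⊕ τ) ⊗ σ ⊕ ℤ.- (1ℤ ⊕ σ) ⊗ (1ℤ ⊕ τ ⊕ (σ ⊖ τ) ⊗ a ⊕ σ ⊗ τ ⊗ d) ⊕ σ ⊗ (1ℤ ⊕ σ) ⊗ a)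
        ⊕ σ ⊗ (1ℤ ⊕ σ) ⊗ (1ℤ ⊕ ℤ.- (1ℤ ⊕ σ) ⊗ a ⊕ σ ⊗ (1ℤ ⊕ σ) ⊗ d)
      ≡ (1ℤ ⊕ σ) ⊗ (σ ⊕ τ) ⊗ (1ℤ ⊕ ℤ.- (1ℤ ⊕ σ) ⊗ a ⊕ σ ⊗ (1ℤ ⊕ σ) ⊗ d)
    poly = solve-ℤ

  ψ-refl : ∀ x → ψ x x ≡ σ ⊗ σ
  ψ-refl x = trans (cong₂ (λ a d → 1ℤ ⊕ ℤ.- (1ℤ ⊕ σ) ⊗ (+ a) ⊕ σ ⊗ (1ℤ ⊕ σ) ⊗ (+ d))
                      (indicator-yes (x ⊥? x) (⊥-refl x)) (indicator-yes (x ≟ᶠ x) refl)) (poly σ)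
    where
    poly : ∀ σ → 1ℤ ⊕ ℤ.- (1ℤ ⊕ σ) ⊗ 1ℤ ⊕ σ ⊗ (1ℤ ⊕ σ) ⊗ 1ℤ ≡ σ ⊗ σ
    poly = solve-ℤ

  ψ-collinear : ∀ {x y} → x ⊥ y → x ≢ y → ψ x y ≡ ℤ.- σ
  ψ-collinear {x} {y} x⊥y x≢y = trans (cong₂ (λ a d → 1ℤ ⊕ ℤ.- (1ℤ ⊕ σ) ⊗ (+ a) ⊕ σ ⊗ (1ℤ ⊕ σ) ⊗ (+ d))
                      (indicator-yes (x ⊥? y) x⊥y) (indicator-no (x ≟ᶠ y) x≢y)) (poly σ)
    where
    poly : ∀ σ → 1ℤ ⊕ ℤ.- (1ℤ ⊕ σ) ⊗ 1ℤ ⊕ σ ⊗ (1ℤ ⊕ σ) ⊗ 0ℤ ≡ ℤ.- σ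
    poly = solve-ℤ

  ψ-noncollinear : ∀ {x y} → ¬ x ⊥ y → ψ x y ≡ 1ℤ
  ψ-noncollinear {x} {y} x≁y = trans (cong₂ (λ a d → 1ℤ ⊕ ℤ.- (1ℤ ⊕ σ) ⊗ (+ a) ⊕ σ ⊗ (1ℤ ⊕ σ) ⊗ (+ d))
                      (indicator-no (x ⊥? y) x≁y) (indicator-no (x ≟ᶠ y) λ { refl → x≁y (⊥-refl x) })) (poly σ)
    where
    poly : ∀ σ → 1ℤ ⊕ ℤ.- (1ℤ ⊕ σ) ⊗ 0ℤ ⊕ σ ⊗ (1ℤ ⊕ σ) ⊗ 0ℤ ≡ 1ℤ
    poly = solve-ℤ

  module Higman {x y} (x≁y : ¬ x ⊥ y) where

    trace? : ∀ z → Dec (x ⊥ z × y ⊥ z)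
    trace? z = (x ⊥? z) ×-dec (y ⊥? z)

    -- Up to a scalar, F is the projection of s 1_W + (t+1)(1_x + 1_y); weights in this ratio make ⟨ F , F ⟩ nearly minimal.
    W Ψ F : Fin np → ℤ
    W z = indicatorᶻ (trace? z)
    Ψ z = Σ.sum (λ w → W w ⊗ ψ w z)
    F z = σ ⊗ Ψ z ⊕ (1ℤ ⊕ τ) ⊗ (ψ x z ⊕ ψ y z)

    sum-W : Σ.sum W ≡ 1ℤ ⊕ τ
    sum-W = trans (sum-indicatorᶻ trace?) (cong +_ (#⊥⊥-noncollinear x≁y))

    on-trace : ∀ w {a b : ℤ} → (x ⊥ w → y ⊥ w → a ≡ b) → W w ⊗ a ≡ W w ⊗ b
    on-trace w {a} {b} eq = cases (trace? w)
      where
      cases : (w? : Dec (x ⊥ w × y ⊥ w)) → indicatorᶻ w? ⊗ a ≡ indicatorᶻ w? ⊗ b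
      cases (yes (xw , yw)) = cong (1ℤ ⊗_) (eq xw yw)
      cases (no _)          = trans (ℤ.*-zeroˡ a) (sym (ℤ.*-zeroˡ b))

    sum-W* : ∀ a → Σ.sum (λ w → W w ⊗ a) ≡ (1ℤ ⊕ τ) ⊗ a
    sum-W* a = trans (sym (Σ.*-distribʳ-sum a W)) (cong (_⊗ a) sum-W)

    Ψ-x : Ψ x ≡ (1ℤ ⊕ τ) ⊗ ℤ.- σ
    Ψ-x = trans (Σ.sum-cong-≗ (λ w → on-trace w {ψ w x} {ℤ.- σ} λ xw yw →
            ψ-collinear (⊥-sym xw) λ { refl → x≁y (⊥-sym yw) })) (sum-W* (ℤ.- σ))

    Ψ-y : Ψ y ≡ (1ℤ ⊕ τ) ⊗ ℤ.- σ
    Ψ-y = trans (Σ.sum-cong-≗ (λ w → on-trace w {ψ w y} {ℤ.- σ} λ xw yw →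
            ψ-collinear (⊥-sym yw) λ { refl → x≁y xw })) (sum-W* (ℤ.- σ))

    -- The line joining two collinear trace points would contain both `x` and `y`.
    trace-coclique : ∀ {v w} → x ⊥ v → y ⊥ v → x ⊥ w → y ⊥ w → v ≢ w → ¬ v ⊥ w
    trace-coclique xv yv xw yw v≢w (l , vl , wl) =
      x≁y (l , no-triangle v≢w vl wl xv xw , no-triangle v≢w vl wl yv yw)

    -- The trace being a coclique, the summand at `w` is s² and the other t are 1.
    Ψ-trace : ∀ {w} → x ⊥ w → y ⊥ w → Ψ w ≡ σ ⊗ σ ⊕ τ
    Ψ-trace {w} xw yw = begin
      Ψ w
        ≡⟨ Σ.sum-cong-≗ (λ v → on-trace v (value v)) ⟩
      Σ.sum (λ v → W v ⊗ (1ℤ ⊕ (σ ⊗ σ ⊖ 1ℤ) ⊗ δ w v))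
        ≡⟨ Σ.sum-cong-≗ (λ v → poly₁ (W v) (σ ⊗ σ ⊖ 1ℤ) (δ w v)) ⟩
      Σ.sum (λ v → W v ⊕ δ w v ⊗ (W v ⊗ (σ ⊗ σ ⊖ 1ℤ)))
        ≡⟨ Σ.∑-distrib-+ W _ ⟩
      Σ.sum W ⊕ Σ.sum (λ v → δ w v ⊗ (W v ⊗ (σ ⊗ σ ⊖ 1ℤ)))
        ≡⟨ cong₂ _⊕_ sum-W (sum-δ (λ v → W v ⊗ (σ ⊗ σ ⊖ 1ℤ)) w) ⟩
      1ℤ ⊕ τ ⊕ W w ⊗ (σ ⊗ σ ⊖ 1ℤ)
        ≡⟨ cong (λ k → 1ℤ ⊕ τ ⊕ + k ⊗ (σ ⊗ σ ⊖ 1ℤ)) (indicator-yes (trace? w) (xw , yw)) ⟩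
      1ℤ ⊕ τ ⊕ 1ℤ ⊗ (σ ⊗ σ ⊖ 1ℤ)
        ≡⟨ poly₂ σ τ ⟩
      σ ⊗ σ ⊕ τ ∎
      where
      poly₁ : ∀ a b d → a ⊗ (1ℤ ⊕ b ⊗ d) ≡ a ⊕ d ⊗ (a ⊗ b)
      poly₁ = solve-ℤ
      poly₂ : ∀ σ τ → 1ℤ ⊕ τ ⊕ 1ℤ ⊗ (σ ⊗ σ ⊖ 1ℤ) ≡ σ ⊗ σ ⊕ τ
      poly₂ = solve-ℤ
      poly₃ : ∀ a → a ≡ 1ℤ ⊕ (a ⊖ 1ℤ) ⊗ 1ℤ
      poly₃ = solve-ℤ
      poly₄ : ∀ a → 1ℤ ≡ 1ℤ ⊕ (a ⊖ 1ℤ) ⊗ 0ℤ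
      poly₄ = solve-ℤ
      value : ∀ v → x ⊥ v → y ⊥ v → ψ v w ≡ 1ℤ ⊕ (σ ⊗ σ ⊖ 1ℤ) ⊗ δ w v
      value v xv yv = cases (w ≟ᶠ v)
        where
        cases : (w≟v : Dec (w ≡ v)) → ψ v w ≡ 1ℤ ⊕ (σ ⊗ σ ⊖ 1ℤ) ⊗ indicatorᶻ w≟v
        cases (yes refl) = trans (ψ-refl w) (poly₃ (σ ⊗ σ))
        cases (no w≢v) = trans (ψ-noncollinear (trace-coclique xv yv xw yw (w≢v ∘ sym))) (poly₄ (σ ⊗ σ))

    ⟨-,Ψ⟩ : ∀ f → ⟨ f , Ψ ⟩ ≡ Σ.sum (λ w → W w ⊗ ⟨ f , ψ w ⟩)
    ⟨-,Ψ⟩ f = begin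
      Σ.sum (λ z → f z ⊗ Σ.sum (λ w → W w ⊗ ψ w z))      ≡⟨ Σ.sum-cong-≗ (λ z → Σ.*-distribˡ-sum (f z) (λ w → W w ⊗ ψ w z)) ⟩
      Σ.sum (λ z → Σ.sum (λ w → f z ⊗ (W w ⊗ ψ w z)))    ≡⟨ Σ.∑-comm (λ z w → f z ⊗ (W w ⊗ ψ w z)) ⟩
      Σ.sum (λ w → Σ.sum (λ z → f z ⊗ (W w ⊗ ψ w z)))    ≡⟨ Σ.sum-cong-≗ (λ w → Σ.sum-cong-≗ (λ z → poly (f z) (W w) (ψ w z))) ⟩
      Σ.sum (λ w → Σ.sum (λ z → W w ⊗ (f z ⊗ ψ w z)))    ≡⟨ Σ.sum-cong-≗ (λ w → Σ.*-distribˡ-sum (W w) (λ z → f z ⊗ ψ w z)) ⟨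
      Σ.sum (λ w → W w ⊗ ⟨ f , ψ w ⟩)                    ∎
      where
      poly : ∀ a b c → a ⊗ (b ⊗ c) ≡ b ⊗ (a ⊗ c)
      poly = solve-ℤ

    ⟨-,F⟩ : ∀ f → ⟨ f , F ⟩ ≡ σ ⊗ Σ.sum (λ w → W w ⊗ ⟨ f , ψ w ⟩) ⊕ (1ℤ ⊕ τ) ⊗ (⟨ f , ψ x ⟩ ⊕ ⟨ f , ψ y ⟩)
    ⟨-,F⟩ f = trans (⟨⟩-linear σ Ψ (1ℤ ⊕ τ) (λ z → ψ x z ⊕ ψ y z) f)
      (cong₂ (λ a b → σ ⊗ a ⊕ (1ℤ ⊕ τ) ⊗ b) (⟨-,Ψ⟩ f)
        (trans (Σ.sum-cong-≗ (λ z → ℤ.*-distribˡ-+ (f z) (ψ x z) (ψ y z)))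
               (Σ.∑-distrib-+ (λ z → f z ⊗ ψ x z) _)))

    -- `F` is a combination of rows of `ψ`, so the Gram relation applies term by term.
    ⟨F,ψ⟩ : ∀ u → ⟨ F , ψ u ⟩ ≡ κ ⊗ F u
    ⟨F,ψ⟩ u = begin
      ⟨ F , ψ u ⟩
        ≡⟨ ⟨⟩-comm F (ψ u) ⟩
      ⟨ ψ u , F ⟩
        ≡⟨ ⟨-,F⟩ (ψ u) ⟩
      σ ⊗ Σ.sum (λ w → W w ⊗ ⟨ ψ u , ψ w ⟩) ⊕ (1ℤ ⊕ τ) ⊗ (⟨ ψ u , ψ x ⟩ ⊕ ⟨ ψ u , ψ y ⟩)
        ≡⟨ cong₂ (λ a b → σ ⊗ a ⊕ (1ℤ ⊕ τ) ⊗ b)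
             (Σ.sum-cong-≗ (λ w → trans (cong (W w ⊗_) (gram w)) (poly₁ (W w) κ (ψ w u))))
             (cong₂ _⊕_ (gram x) (gram y)) ⟩
      σ ⊗ Σ.sum (λ w → κ ⊗ (W w ⊗ ψ w u)) ⊕ (1ℤ ⊕ τ) ⊗ (κ ⊗ ψ x u ⊕ κ ⊗ ψ y u)
        ≡⟨ cong (λ a → σ ⊗ a ⊕ (1ℤ ⊕ τ) ⊗ (κ ⊗ ψ x u ⊕ κ ⊗ ψ y u)) (Σ.*-distribˡ-sum κ (λ w → W w ⊗ ψ w u)) ⟨
      σ ⊗ (κ ⊗ Ψ u) ⊕ (1ℤ ⊕ τ) ⊗ (κ ⊗ ψ x u ⊕ κ ⊗ ψ y u)
        ≡⟨ poly₂ σ τ κ (Ψ u) (ψ x u) (ψ y u) ⟩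
      κ ⊗ F u ∎
      where
      gram : ∀ w → ⟨ ψ u , ψ w ⟩ ≡ κ ⊗ ψ w u
      gram w = trans (⟨ψ,ψ⟩ u w) (cong (κ ⊗_) (ψ-sym u w))
      poly₁ : ∀ a k b → a ⊗ (k ⊗ b) ≡ k ⊗ (a ⊗ b)
      poly₁ = solve-ℤ
      poly₂ : ∀ σ τ k a b c → σ ⊗ (k ⊗ a) ⊕ (1ℤ ⊕ τ) ⊗ (k ⊗ b ⊕ k ⊗ c) ≡ k ⊗ (σ ⊗ a ⊕ (1ℤ ⊕ τ) ⊗ (b ⊕ c))
      poly₂ = solve-ℤ

    F-x : F x ≡ 1ℤ ⊕ τ
    F-x = trans (cong₂ (λ a b → σ ⊗ a ⊕ (1ℤ ⊕ τ) ⊗ b) Ψ-x (cong₂ _⊕_ (ψ-refl x) (ψ-noncollinear (x≁y ∘ ⊥-sym)))) (poly σ τ)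
      where
      poly : ∀ σ τ → σ ⊗ ((1ℤ ⊕ τ) ⊗ ℤ.- σ) ⊕ (1ℤ ⊕ τ) ⊗ (σ ⊗ σ ⊕ 1ℤ) ≡ 1ℤ ⊕ τ
      poly = solve-ℤ

    F-y : F y ≡ 1ℤ ⊕ τ
    F-y = trans (cong₂ (λ a b → σ ⊗ a ⊕ (1ℤ ⊕ τ) ⊗ b) Ψ-y (cong₂ _⊕_ (ψ-noncollinear x≁y) (ψ-refl y))) (poly σ τ)
      where
      poly : ∀ σ τ → σ ⊗ ((1ℤ ⊕ τ) ⊗ ℤ.- σ) ⊕ (1ℤ ⊕ τ) ⊗ (1ℤ ⊕ σ ⊗ σ) ≡ 1ℤ ⊕ τ
      poly = solve-ℤ

    F-trace : ∀ {w} → x ⊥ w → y ⊥ w → F w ≡ σ ⊗ (σ ⊗ σ ⊖ τ ⊖ (1ℤ ⊕ 1ℤ))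
    F-trace xw yw = trans
      (cong₂ (λ a b → σ ⊗ a ⊕ (1ℤ ⊕ τ) ⊗ b) (Ψ-trace xw yw)
        (cong₂ _⊕_ (ψ-collinear xw (λ { refl → x≁y (⊥-sym yw) })) (ψ-collinear yw (λ { refl → x≁y xw })))) (poly σ τ)
      where
      poly : ∀ σ τ → σ ⊗ (σ ⊗ σ ⊕ τ) ⊕ (1ℤ ⊕ τ) ⊗ (ℤ.- σ ⊕ ℤ.- σ) ≡ σ ⊗ (σ ⊗ σ ⊖ τ ⊖ (1ℤ ⊕ 1ℤ))
      poly = solve-ℤ

    -- Equal to (s² - 2)(s² - t) + 2, so for s ≥ 2 its nonnegativity is a slightly weaker form of
    -- Higman's t ≤ s².
    gap : ℤ
    gap = σ ⊗ σ ⊗ (σ ⊗ σ ⊖ τ ⊖ (1ℤ ⊕ 1ℤ)) ⊕ (1ℤ ⊕ 1ℤ) ⊗ (1ℤ ⊕ τ)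

    ⟨F,F⟩ : ⟨ F , F ⟩ ≡ κ ⊗ (1ℤ ⊕ τ) ⊗ gap
    ⟨F,F⟩ = begin
      ⟨ F , F ⟩
        ≡⟨ ⟨-,F⟩ F ⟩
      σ ⊗ Σ.sum (λ w → W w ⊗ ⟨ F , ψ w ⟩) ⊕ (1ℤ ⊕ τ) ⊗ (⟨ F , ψ x ⟩ ⊕ ⟨ F , ψ y ⟩)
        ≡⟨ cong₂ (λ a b → σ ⊗ a ⊕ (1ℤ ⊕ τ) ⊗ b)
             (trans (Σ.sum-cong-≗ (λ w → on-trace w λ xw yw → trans (⟨F,ψ⟩ w) (cong (κ ⊗_) (F-trace xw yw))))
                    (sum-W* (κ ⊗ (σ ⊗ (σ ⊗ σ ⊖ τ ⊖ (1ℤ ⊕ 1ℤ))))))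
             (cong₂ _⊕_ (trans (⟨F,ψ⟩ x) (cong (κ ⊗_) F-x)) (trans (⟨F,ψ⟩ y) (cong (κ ⊗_) F-y))) ⟩
      σ ⊗ ((1ℤ ⊕ τ) ⊗ (κ ⊗ (σ ⊗ (σ ⊗ σ ⊖ τ ⊖ (1ℤ ⊕ 1ℤ))))) ⊕ (1ℤ ⊕ τ) ⊗ (κ ⊗ (1ℤ ⊕ τ) ⊕ κ ⊗ (1ℤ ⊕ τ))
        ≡⟨ poly σ τ κ ⟩
      κ ⊗ (1ℤ ⊕ τ) ⊗ gap ∎
      where
      poly : ∀ σ τ k →
        σ ⊗ ((1ℤ ⊕ τ) ⊗ (k ⊗ (σ ⊗ (σ ⊗ σ ⊖ τ ⊖ (1ℤ ⊕ 1ℤ))))) ⊕ (1ℤ ⊕ τ) ⊗ (k ⊗ (1ℤ ⊕ τ) ⊕ k ⊗ (1ℤ ⊕ τ))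
        ≡ k ⊗ (1ℤ ⊕ τ) ⊗ (σ ⊗ σ ⊗ (σ ⊗ σ ⊖ τ ⊖ (1ℤ ⊕ 1ℤ)) ⊕ (1ℤ ⊕ 1ℤ) ⊗ (1ℤ ⊕ τ))
      poly = solve-ℤ

    -- `⟨ F , F ⟩` is a sum of squares and a positive multiple of `gap`. The conclusion is the
    -- nonnegativity of `gap` with the negative terms moved across.
    higman : 0 < s → s * s * (t + 2) ≤ s * s * (s * s) + 2 * suc t
    -- Exposing `s` as a successor makes the factor `κ ⊗ (1ℤ ⊕ τ)` positive, so it can be cancelled.
    higman (s≤s _) = ℤ.drop‿+≤+ (ℤ.i-j≤0⇒i≤j (ℤ.neg-cancel-≤ (subst (0ℤ ℤ.≤_) gap≡ 0≤gap)))
      where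
      0≤gap : 0ℤ ℤ.≤ gap
      0≤gap = ℤ.*-cancelˡ-≤-pos 0ℤ gap (κ ⊗ (1ℤ ⊕ τ))
        (subst (ℤ._≤ κ ⊗ (1ℤ ⊕ τ) ⊗ gap) (sym (ℤ.*-zeroʳ (κ ⊗ (1ℤ ⊕ τ))))
          (subst (0ℤ ℤ.≤_) ⟨F,F⟩ (sum-nonneg _ (square-nonneg ∘ F))))
      gap≡ : gap ≡ ℤ.- (+ (s * s * (t + 2)) ⊖ + (s * s * (s * s) + 2 * suc t))
      gap≡ = begin
        gap
          ≡⟨ poly σ τ ⟩
        ℤ.- (σ ⊗ σ ⊗ (τ ⊕ + 2) ⊖ (σ ⊗ σ ⊗ (σ ⊗ σ) ⊕ + 2 ⊗ (1ℤ ⊕ τ)))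
          ≡⟨ cong₂ (λ a b → ℤ.- (a ⊖ b))
               (trans (ℤ.pos-* (s * s) (t + 2)) (cong (_⊗ + (t + 2)) (ℤ.pos-* s s)))
               (cong₂ _⊕_ (trans (ℤ.pos-* (s * s) (s * s)) (cong₂ _⊗_ (ℤ.pos-* s s) (ℤ.pos-* s s))) (ℤ.pos-* 2 (suc t))) ⟨
        ℤ.- (+ (s * s * (t + 2)) ⊖ + (s * s * (s * s) + 2 * suc t)) ∎
        where
        poly : ∀ σ τ → σ ⊗ σ ⊗ (σ ⊗ σ ⊖ τ ⊖ (1ℤ ⊕ 1ℤ)) ⊕ (1ℤ ⊕ 1ℤ) ⊗ (1ℤ ⊕ τ)
             ≡ ℤ.- (σ ⊗ σ ⊗ (τ ⊕ + 2) ⊖ (σ ⊗ σ ⊗ (σ ⊗ σ) ⊕ + 2 ⊗ (1ℤ ⊕ τ)))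
        poly = solve-ℤ

-- Arithmetic of class sizes and centralising lines.

-- Writing k = 1 + m s turns k (1 + c s) = 1 + t s into t = m + c + m c s.
centraliser-count : ∀ {s t c k x} → 2 ≤ s → 2 ≤ t → k * suc (c * s) ≡ suc (t * s) → 1 < k → k ≤ suc t →
  c + x ≡ t → suc s ∣ x → s * s * (t + 2) ≤ s * s * (s * s) + 2 * suc t → c ≡ 1
centraliser-count {s} {t} {c} {suc k} {x} 2≤s 2≤t k-eq (s≤s 0<k) k≤ c+x≡t s+1∣x higman = go k≡ms
  where
  -- From here `k` is the class size less one, and `k+` is `k-eq` with 1 taken off both sides; hence
  -- s divides `k`.
  k+ : k + (suc k * c) * s ≡ t * s
  k+ = suc-injective (trans (lemma k c s) k-eq)
    where
    lemma : ∀ k c s → suc (k + (suc k * c) * s) ≡ suc k * suc (c * s)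
    lemma = solve-ℕ
  k≡ms : s ∣ k
  k≡ms = ∣m+n∣m⇒∣n (subst (s ∣_) (trans (sym k+) (+-comm k _)) (n∣m*n t)) (n∣m*n (suc k * c))
  go : s ∣ k → c ≡ 1
  go (divides zero refl) = contradiction 0<k λ ()
  go (divides (suc n) refl) = cases c refl
    where
    m = suc n
    open ≡-Reasoning
    t≡ : c + (m + m * c * s) ≡ t
    t≡ = *-cancelʳ-≡ _ _ s {{>-nonZero (≤-trans (s≤s z≤n) 2≤s)}} (trans (lemma m c s) k+)
      where
      lemma : ∀ m c s → (c + (m + m * c * s)) * s ≡ m * s + (suc (m * s) * c) * s
      lemma = solve-ℕ
    x≡ : x ≡ m + m * c * s
    x≡ = +-cancelˡ-≡ c _ _ (trans c+x≡t (sym t≡))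
    cases : ∀ c′ → c ≡ c′ → c ≡ 1
    -- For c = 0 the class would have 1 + ts lines, more than 1 + t.
    cases zero refl = contradiction (s≤s⁻¹ (≤-trans (≤-reflexive (sym k-eq′)) k≤)) (<⇒≱ t<ts)
      where
      k-eq′ : suc (m * s) ≡ suc (t * s)
      k-eq′ = trans (sym (*-identityʳ _)) k-eq
      t<ts : t < t * s
      t<ts = m<m*n t s {{>-nonZero (≤-trans (s≤s z≤n) 2≤t)}} 2≤s
    cases (suc zero) refl = refl
    -- For c ≥ 2: modulo s + 1, x = m + mcs is -m(c - 1), so s + 1 ≤ m(c - 1) and mc ≥ s + 2. Then t
    -- = c + m + mcs is at least s² + 2s + 3, which violates the inequality.
    cases (suc (suc d)) refl = contradiction higman (<⇒≱ (too-big 2≤s t≥))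
      where
      s+1∣ : suc s ∣ m * suc d
      s+1∣ = ∣m+n∣m⇒∣n (subst (suc s ∣_) (trans (lemma m (suc d) s) (cong (_+ m * suc d) (sym x≡))) (n∣m*n (m + m * suc d))) s+1∣x
        where
        lemma : ∀ m d s → (m + m * d) * suc s ≡ m + m * suc d * s + m * d
        lemma = solve-ℕ
      s+1≤ : suc s ≤ m * suc d
      s+1≤ = ∣⇒≤ s+1∣
      t≥ : s * s + 2 * s + 3 ≤ t
      t≥ = ≤-trans (≤-reflexive (lemma s)) (≤-trans
             (+-mono-≤ (s≤s (s≤s (z≤n {d}))) (+-mono-≤ (s≤s (z≤n {n})) (*-monoˡ-≤ s
               (≤-trans (s≤s s+1≤) (≤-trans (+-monoˡ-≤ (m * suc d) (s≤s (z≤n {n}))) (≤-reflexive (sym (*-suc m (suc d)))))))))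
             (≤-reflexive t≡))
        where
        lemma : ∀ s → s * s + 2 * s + 3 ≡ 2 + (1 + suc (suc s) * s)
        lemma = solve-ℕ
      too-big : ∀ {s t} → 2 ≤ s → s * s + 2 * s + 3 ≤ t → s * s * (s * s) + 2 * suc t < s * s * (t + 2)
      too-big 2≤s t≥ with m≤n⇒∃[o]m+o≡n 2≤s | m≤n⇒∃[o]m+o≡n t≥
      -- With s = 2 + r and t = s² + 2s + 3 + u, the added polynomial is the difference of the two
      -- sides less one; its coefficients are nonnegative.
      ... | r , refl | u , refl = ≤-trans (m≤m+n _ (11 + 32 * r + 15 * (r * r) + 2 * (r * r * r) + (2 + 4 * r + r * r) * u)) (≤-reflexive (lemma r u))
        where
        lemma : ∀ r u → suc ((2 + r) * (2 + r) * ((2 + r) * (2 + r)) + 2 * suc ((2 + r) * (2 + r) + 2 * (2 + r) + 3 + u))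
                  + (11 + 32 * r + 15 * (r * r) + 2 * (r * r * r) + (2 + 4 * r + r * r) * u)
                ≡ (2 + r) * (2 + r) * ((2 + r) * (2 + r) + 2 * (2 + r) + 3 + u + 2)
        lemma = solve-ℕ

-- Multiplying by 1 + s, the number k(1 + s) = 1 + ts would divide (t + 1)(1 + s) = (1 + ts) + (s +
-- t), hence s + t. But 1 + ts exceeds s + t by (s - 1)(t - 1). The form `1 * s` is the case c = 1
-- of the general class equation.
orbit-size-∤ : ∀ {s t k} → 2 ≤ s → 2 ≤ t → k * suc (1 * s) ≡ suc (t * s) → ¬ k ∣ suc t
orbit-size-∤ {s} {t} {k} 2≤s 2≤t k-eq (divides q t+1≡qk) = too-big 2≤s 2≤t (∣⇒≤ {{>-nonZero (≤-trans (≤-trans (s≤s z≤n) 2≤s) (m≤m+n s t))}} 1+ts∣s+t)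
  where
  total : suc (t * s) + (s + t) ≡ q * suc (t * s)
  total = trans (lemma s t) (trans (cong (_* suc (1 * s)) t+1≡qk) (trans (*-assoc q k _) (cong (q *_) k-eq)))
    where
    lemma : ∀ s t → suc (t * s) + (s + t) ≡ suc t * suc (1 * s)
    lemma = solve-ℕ
  1+ts∣s+t : suc (t * s) ∣ s + t
  1+ts∣s+t = ∣m+n∣m⇒∣n (divides q total) ∣-refl
  too-big : ∀ {s t} → 2 ≤ s → 2 ≤ t → ¬ suc (t * s) ≤ s + t
  too-big 2≤s 2≤t with m≤n⇒∃[o]m+o≡n 2≤s | m≤n⇒∃[o]m+o≡n 2≤t
  ... | a , refl | b , refl = <⇒≱ (≤-trans (m≤m+n _ (a + b + b * a)) (≤-reflexive (lemma a b)))
    where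
    lemma : ∀ a b → suc ((2 + a) + (2 + b)) + (a + b + b * a) ≡ suc ((2 + b) * (2 + a))
    lemma = solve-ℕ

-- Lines through the identity as subgroups.

module TwoSidedAction {np nl s t} (inc : Incidence np nl) (gq : IsGQOfOrder inc s t) (2≤s : 2 ≤ s) (2≤t : 2 ≤ t)
  {_∙_ : Fin np → Fin np → Fin np} {ε : Fin np} {_⁻¹ : Fin np → Fin np} (isGroup : IsGroup _≡_ _∙_ ε _⁻¹)
  (translate : Fin np → Fin np → Fin nl → Fin nl)
  (translate-inc : ∀ a b {x l} → inc x l ≡ inc ((a ∙ x) ∙ b) (translate a b l))
  where

  open Quadrangle inc gq
  open Spectral inc gq using (module Higman)
  open IsGroup isGroup using (assoc; identityˡ; identityʳ; inverseˡ; inverseʳ; _\\_)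

  group : Group 0ℓ 0ℓ
  group = record { isGroup = isGroup }

  open GroupProperties group

  translate-∈ : ∀ a b {x l} → x ∈ l → ((a ∙ x) ∙ b) ∈ translate a b l
  translate-∈ a b xl = trans (sym (translate-inc a b)) xl

  translate-⊥ : ∀ a b {x y} → x ⊥ y → ((a ∙ x) ∙ b) ⊥ ((a ∙ y) ∙ b)
  translate-⊥ a b (l , xl , yl) = translate a b l , translate-∈ a b xl , translate-∈ a b yl

  ∙-⊥ˡ : ∀ a {x y} → x ⊥ y → (a ∙ x) ⊥ (a ∙ y)
  ∙-⊥ˡ a {x} {y} x⊥y = subst₂ _⊥_ (identityʳ (a ∙ x)) (identityʳ (a ∙ y)) (translate-⊥ a ε x⊥y)

  ∙-⊥ʳ : ∀ b {x y} → x ⊥ y → (x ∙ b) ⊥ (y ∙ b)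
  ∙-⊥ʳ b {x} {y} x⊥y = subst₂ _⊥_ (cong (_∙ b) (identityˡ x)) (cong (_∙ b) (identityˡ y)) (translate-⊥ ε b x⊥y)

  -- Multiplying by x⁻¹ on the left and y⁻¹ on the right sends `x` to y⁻¹ and `y` to x⁻¹.
  ⁻¹-⊥ : ∀ {x y} → x ⊥ y → (x ⁻¹) ⊥ (y ⁻¹)
  ⁻¹-⊥ {x} {y} x⊥y = ⊥-sym (subst₂ _⊥_
    (trans (cong (_∙ (y ⁻¹)) (inverseˡ x)) (identityˡ (y ⁻¹)))
    (//-rightDividesʳ y (x ⁻¹))
    (translate-⊥ (x ⁻¹) (y ⁻¹) x⊥y))

  ∃≢ε : ∀ l → ∃[ x ] (x ∈ l × x ≢ ε)
  ∃≢ε l = #-avoid (_∈? l) (subst (1 <_) (sym (#line l)) (s≤s (≤-trans (s≤s z≤n) 2≤s))) ε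

  -- For a, b on a line l through ε, the element (a⁻¹ b)⁻¹ is collinear with ε and, as a⁻¹ b ⊥ a⁻¹, also with a.
  \\-∈ : ∀ {l a b} → ε ∈ l → a ∈ l → b ∈ l → a ≢ ε → (b \\ a) ∈ l
  \\-∈ {l} {a} {b} εl al bl a≢ε = no-triangle a≢ε al εl
    (subst₂ _⊥_ (⁻¹-anti-homo-\\ a b) (trans (cong _⁻¹ (identityʳ (a ⁻¹))) (⁻¹-involutive a))
       (⁻¹-⊥ (∙-⊥ˡ (a ⁻¹) (l , bl , εl))))
    (subst ((b \\ a) ⊥_) (inverseˡ b) (∙-⊥ˡ (b ⁻¹) (l , al , bl)))

  -- As s ≥ 2, there is a third point `b` on `l`. With c = b⁻¹a, both c and c⁻¹ = a⁻¹b are on `l`,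
  -- and inverting a ⊥ c and a ⊥ ε shows a⁻¹ collinear with the distinct points c⁻¹ and ε of `l`.
  ⁻¹-∈ : ∀ {l a} → ε ∈ l → a ∈ l → (a ⁻¹) ∈ l
  ⁻¹-∈ {l} {a} εl al with a ≟ᶠ ε
  ... | yes refl = subst (_∈ l) (sym ε⁻¹≈ε) εl
  ... | no a≢ε =
    let b , bl , b≢ε , b≢a = #-avoid₂ (_∈? l) (subst (2 <_) (sym (#line l)) (s≤s 2≤s)) ε a
        c≢ε = λ c≡ε → b≢a (sym (trans (sym (\\-leftDividesˡ b a)) (trans (cong (b ∙_) c≡ε) (identityʳ b))))
        cl = \\-∈ εl al bl a≢ε
        c⁻¹l = subst (_∈ l) (sym (⁻¹-anti-homo-\\ b a)) (\\-∈ εl bl al b≢ε)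
    in no-triangle (λ c⁻¹≡ε → c≢ε (⁻¹-injective (trans c⁻¹≡ε (sym ε⁻¹≈ε)))) c⁻¹l εl
         (⁻¹-⊥ (l , al , cl))
         (subst ((a ⁻¹) ⊥_) ε⁻¹≈ε (⁻¹-⊥ (l , al , εl)))

  ∙-∈ : ∀ {l a b} → ε ∈ l → a ∈ l → b ∈ l → (a ∙ b) ∈ l
  ∙-∈ {l} {a} {b} εl al bl with b ≟ᶠ ε
  ... | yes refl = subst (_∈ l) (sym (identityʳ a)) al
  ... | no b≢ε = subst (λ c → (c ∙ b) ∈ l) (⁻¹-involutive a) (\\-∈ εl bl (⁻¹-∈ εl al) b≢ε)

  -- Conjugation on the lines through the identity.

  conj : Fin np → Fin np → Fin np
  conj g x = (g ∙ x) ∙ (g ⁻¹)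

  conj-ε : ∀ g → conj g ε ≡ ε
  conj-ε g = trans (cong (_∙ (g ⁻¹)) (identityʳ g)) (inverseʳ g)

  conj-∙ : ∀ g h x → conj (g ∙ h) x ≡ conj g (conj h x)
  conj-∙ g h x = begin
    ((g ∙ h) ∙ x) ∙ ((g ∙ h) ⁻¹)        ≡⟨ cong₂ _∙_ (assoc g h x) (⁻¹-anti-homo-∙ g h) ⟩
    (g ∙ (h ∙ x)) ∙ ((h ⁻¹) ∙ (g ⁻¹))    ≡⟨ assoc _ (h ⁻¹) (g ⁻¹) ⟨
    ((g ∙ (h ∙ x)) ∙ (h ⁻¹)) ∙ (g ⁻¹)    ≡⟨ cong (_∙ (g ⁻¹)) (assoc g (h ∙ x) (h ⁻¹)) ⟩
    conj g (conj h x)                  ∎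
    where open ≡-Reasoning

  conj-identity : ∀ x → conj ε x ≡ x
  conj-identity x = trans (cong₂ _∙_ (identityˡ x) ε⁻¹≈ε) (identityʳ x)

  conj-≢ε : ∀ g {x} → x ≢ ε → conj g x ≢ ε
  conj-≢ε g {x} x≢ε eq = x≢ε (begin
    x                                 ≡⟨ conj-identity x ⟨
    conj ε x                          ≡⟨ cong (λ c → conj c x) (inverseˡ g) ⟨
    conj ((g ⁻¹) ∙ g) x               ≡⟨ conj-∙ (g ⁻¹) g x ⟩
    conj (g ⁻¹) (conj g x)            ≡⟨ cong (conj (g ⁻¹)) eq ⟩
    conj (g ⁻¹) ε                     ≡⟨ conj-ε (g ⁻¹) ⟩
    ε                                 ∎)
    where open ≡-Reasoning

  commute⇒conj≡ : ∀ {g x} → (g ∙ x) ≡ (x ∙ g) → conj g x ≡ x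
  commute⇒conj≡ {g} {x} eq = trans (cong (_∙ (g ⁻¹)) eq) (//-rightDividesʳ g x)

  conj≡⇒commute : ∀ {g x} → conj g x ≡ x → (g ∙ x) ≡ (x ∙ g)
  conj≡⇒commute {g} {x} eq = trans (sym (//-rightDividesˡ g (g ∙ x))) (cong (_∙ g) eq)

  infixr 7 _^_

  _^_ : Fin np → Fin nl → Fin nl
  g ^ l = translate g (g ⁻¹) l

  conj-∈ : ∀ g {x l} → x ∈ l → conj g x ∈ g ^ l
  conj-∈ g = translate-∈ g (g ⁻¹)

  ε∈^ : ∀ g {l} → ε ∈ l → ε ∈ g ^ l
  ε∈^ g {l} εl = subst (_∈ g ^ l) (conj-ε g) (conj-∈ g εl)

  -- `translate` is known only through incidence, so the action laws are not given. A line through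
  -- `ε` is determined by one further point, and the laws below follow by tracking such a point.
  ^-unique : ∀ g {x l m} → ε ∈ l → x ∈ l → x ≢ ε → ε ∈ m → conj g x ∈ m → g ^ l ≡ m
  ^-unique g εl xl x≢ε εm xm = line-unique (conj-≢ε g x≢ε) (conj-∈ g xl) (ε∈^ g εl) xm εm

  ^-∙ : ∀ g h {l} → ε ∈ l → (g ∙ h) ^ l ≡ g ^ h ^ l
  ^-∙ g h {l} εl = let x , xl , x≢ε = ∃≢ε l in
    ^-unique (g ∙ h) εl xl x≢ε (ε∈^ g (ε∈^ h εl)) (subst (_∈ g ^ h ^ l) (sym (conj-∙ g h x)) (conj-∈ g (conj-∈ h xl)))

  ^-identity : ∀ {l} → ε ∈ l → ε ^ l ≡ l
  ^-identity {l} εl = let x , xl , x≢ε = ∃≢ε l in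
    ^-unique ε εl xl x≢ε εl (subst (_∈ l) (sym (conj-identity x)) xl)

  ^-inverse : ∀ g {l m} → ε ∈ l → g ^ l ≡ m → (g ⁻¹) ^ m ≡ l
  ^-inverse g {l} εl refl = trans (sym (^-∙ (g ⁻¹) g εl)) (trans (cong (_^ l) (inverseˡ g)) (^-identity εl))

  commute⇒^≡ : ∀ {g x l} → ε ∈ l → x ∈ l → x ≢ ε → (g ∙ x) ≡ (x ∙ g) → g ^ l ≡ l
  commute⇒^≡ {g} {l = l} εl xl x≢ε gx = ^-unique g εl xl x≢ε εl (subst (_∈ l) (sym (commute⇒conj≡ gx)) xl)

  ∈⇒^≡ : ∀ {g l} → ε ∈ l → g ∈ l → g ^ l ≡ l
  ∈⇒^≡ {g} {l} εl gl = let x , xl , x≢ε = ∃≢ε l in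
    ^-unique g εl xl x≢ε εl (∙-∈ εl (∙-∈ εl gl xl) (⁻¹-∈ εl gl))

  -- With b′ = h b h⁻¹, the point h b = b′ h is collinear with both b and b′ on i.
  normalise⇒commute : ∀ {i j h b} → ε ∈ i → ε ∈ j → i ≢ j → h ∈ j → b ∈ i → h ^ i ≡ i → (h ∙ b) ≡ (b ∙ h)
  normalise⇒commute {i} {j} {h} {b} εi εj i≢j hj bi hi with h ≟ᶠ ε | conj h b ≟ᶠ b
  ... | yes refl | _ = trans (identityˡ b) (sym (identityʳ b))
  ... | no _ | yes eq = conj≡⇒commute eq
  ... | no h≢ε | no b′≢b = contradiction (line-unique h≢ε hi′ εi hj εj) i≢j
    where
    b′i : conj h b ∈ i
    b′i = subst (conj h b ∈_) hi (conj-∈ h bi)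
    hb : (h ∙ b) ∈ i
    hb = no-triangle b′≢b b′i bi
      (subst₂ _⊥_ (//-rightDividesˡ h (h ∙ b)) (identityʳ (conj h b)) (∙-⊥ˡ (conj h b) (j , hj , εj)))
      (subst ((h ∙ b) ⊥_) (identityˡ b) (∙-⊥ʳ b (j , hj , εj)))
    hi′ : h ∈ i
    hi′ = subst (_∈ i) (//-rightDividesʳ b h) (∙-∈ εi hb (⁻¹-∈ εi bi))

  Commuting : Fin nl → Fin nl → Set
  Commuting i j = ∀ x y → x ∈ i → y ∈ j → (x ∙ y) ≡ (y ∙ x)

  Commuting? : ∀ i j → Dec (Commuting i j)
  Commuting? i j = all? λ x → all? λ y → (x ∈? i) →-dec ((y ∈? j) →-dec ((x ∙ y) ≟ᶠ (y ∙ x)))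

  normalise⇒Commuting : ∀ {i j h} → ε ∈ i → ε ∈ j → i ≢ j → h ∈ j → h ≢ ε → h ^ i ≡ i → Commuting i j
  normalise⇒Commuting {i} {j} {h} εi εj i≢j hj h≢ε hi x y xi yj =
    normalise⇒commute εj εi (i≢j ∘ sym) xi yj
      (commute⇒^≡ εj hj h≢ε (sym (normalise⇒commute εi εj i≢j hj xi hi)))

  -- Orbits of a subgroup on the lines through the identity.

  module Orbits {S : Fin np → Set} (S? : ∀ g → Dec (S g))
                (S-ε : S ε) (S-∙ : ∀ {g h} → S g → S h → S (g ∙ h)) (S-⁻¹ : ∀ {g} → S g → S (g ⁻¹)) where

    Orbit : Fin nl → Fin nl → Set
    Orbit i j = ε ∈ i × ∃[ g ] (S g × g ^ i ≡ j)

    Orbit? : ∀ i j → Dec (Orbit i j)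
    Orbit? i j = (ε ∈? i) ×-dec any? (λ g → S? g ×-dec ((g ^ i) ≟ᶠ j))

    Stabiliser? : ∀ i g → Dec (S g × g ^ i ≡ i)
    Stabiliser? i g = S? g ×-dec ((g ^ i) ≟ᶠ i)

    Orbit-refl : ∀ i → ε ∈ i → Orbit i i
    Orbit-refl i εi = εi , ε , S-ε , ^-identity εi

    Orbit-sym : ∀ i j → Orbit i j → Orbit j i
    Orbit-sym i j (εi , g , Sg , refl) = ε∈^ g εi , (g ⁻¹) , S-⁻¹ Sg , ^-inverse g εi refl

    Orbit-trans : ∀ i j k → Orbit i j → Orbit j k → Orbit i k
    Orbit-trans i j k (εi , g , Sg , refl) (_ , h , Sh , refl) = εi , (h ∙ g) , S-∙ Sh Sg , ^-∙ h g εi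

    -- The fibres of g ↦ `g ^ i` are left cosets of the stabiliser, matched with it by left
    -- translation.
    orbit-stabiliser : ∀ {i} → ε ∈ i → # S? ≡ # (Orbit? i) * # (Stabiliser? i)
    orbit-stabiliser {i} εi = #-fibres S? (Orbit? i) (λ g j → S? g ×-dec ((g ^ i) ≟ᶠ j)) (# (Stabiliser? i))
      (λ { {g} (Sg , gi) → Sg , εi , g , Sg , gi })
      (λ g Sg → g ^ i , (Sg , refl) , λ _ → sym ∘ proj₂)
      λ { j (_ , g , Sg , gi) →
        #-bijection (λ h → S? h ×-dec ((h ^ i) ≟ᶠ j)) (Stabiliser? i) (g \\_) (g ∙_)
          (λ h (Sh , hi) → S-∙ (S-⁻¹ Sg) Sh ,
            trans (^-∙ (g ⁻¹) h εi) (trans (cong ((g ⁻¹) ^_) hi) (^-inverse g εi gi)))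
          (λ h (Sh , hi) → S-∙ Sg Sh , trans (^-∙ g h εi) (trans (cong (g ^_) hi) gi))
          (\\-leftDividesˡ g) (\\-leftDividesʳ g) }

  -- Centralising lines and the normaliser of a line.

  module _ (i : Fin nl) (εi : ε ∈ i) where

    Centralising? : ∀ j → Dec (ε ∈ j × j ≢ i × Commuting i j)
    Centralising? j = (ε ∈? j) ×-dec (¬? (j ≟ᶠ i) ×-dec Commuting? i j)

    Noncentralising? : ∀ j → Dec (ε ∈ j × j ≢ i × ¬ Commuting i j)
    Noncentralising? j = (ε ∈? j) ×-dec (¬? (j ≟ᶠ i) ×-dec ¬? (Commuting? i j))

    -- A transversal of `i` in its normaliser. `ε` is listed separately so that it is present even
    -- if no line centralises `i`.
    Complement : Fin np → Set
    Complement y = y ≡ ε ⊎ ∃[ j ] ((ε ∈ j × j ≢ i × Commuting i j) × y ∈ j)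

    Complement? : ∀ y → Dec (Complement y)
    Complement? y = (y ≟ᶠ ε) ⊎-dec any? (λ j → Centralising? j ×-dec (y ∈? j))

    #Complement : # Complement? ≡ suc (# Centralising? * s)
    #Complement = trans (#-remove Complement? ε (inj₁ refl)) (cong suc
      (#-fibres (λ y → Complement? y ×-dec ¬? (y ≟ᶠ ε)) Centralising?
        (λ y j → Centralising? j ×-dec ((y ∈? j) ×-dec ¬? (y ≟ᶠ ε))) s
        (λ { {y} {j} (cj , yj , y≢ε) → (inj₂ (j , cj , yj) , y≢ε) , cj })
        (λ { y (inj₁ y≡ε , y≢ε) → contradiction y≡ε y≢ε
           ; y (inj₂ (j , cj , yj) , y≢ε) → j , (cj , yj , y≢ε) ,
               λ { k ((εk , _) , yk , _) → line-unique y≢ε yk εk yj (proj₁ cj) } })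
        (λ j cj → trans
          (#-cong (λ y → Centralising? j ×-dec ((y ∈? j) ×-dec ¬? (y ≟ᶠ ε))) (λ y → (y ∈? j) ×-dec ¬? (y ≟ᶠ ε))
            (λ _ → proj₂) (λ _ → cj ,_))
          (suc-injective (trans (sym (#-remove (_∈? j) ε (proj₁ cj))) (#line j))))))

    -- Each g normalising `i` is uniquely a product ay with a in `i` and y in the complement. If g
    -- is in `i`, then a = g; otherwise a is the projection of g to `i`. Two factorisations of a g
    -- off `i` would give two points of `i` collinear with g.
    #normaliser : # (λ g → (g ^ i) ≟ᶠ i) ≡ suc s * suc (# Centralising? * s)
    #normaliser = trans
      (#-fibres (λ g → (g ^ i) ≟ᶠ i) (_∈? i) (λ g a → (a ∈? i) ×-dec Complement? (a \\ g)) (suc (# Centralising? * s))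
        (λ { {g} {a} (ai , y) → normalises ai y , ai })
        factor
        (λ a ai → trans
          (#-bijection (λ g → (a ∈? i) ×-dec Complement? (a \\ g)) Complement? (a \\_) (a ∙_)
            (λ _ → proj₂)
            (λ y cy → ai , subst Complement (sym (\\-leftDividesʳ a y)) cy)
            (\\-leftDividesˡ a) (\\-leftDividesʳ a))
          #Complement))
      (cong (_* suc (# Centralising? * s)) (#line i))
      where
      normalises : ∀ {g a} → a ∈ i → Complement (a \\ g) → g ^ i ≡ i
      normalises {g} {a} ai y = trans (cong (_^ i) (sym (\\-leftDividesˡ a g)))
        (trans (^-∙ a (a \\ g) εi) (trans (cong (a ^_) (complement-fixes y)) (∈⇒^≡ εi ai)))
        where
        complement-fixes : ∀ {y} → Complement y → y ^ i ≡ i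
        complement-fixes (inj₁ refl) = ^-identity εi
        complement-fixes {y} (inj₂ (j , (_ , _ , ij) , yj)) = let x , xi , x≢ε = ∃≢ε i in
          commute⇒^≡ εi xi x≢ε (sym (ij x y xi yj))
      factor : ∀ g → g ^ i ≡ i → ∃[ a ] ((a ∈ i × Complement (a \\ g)) ×
               (∀ a′ → a′ ∈ i × Complement (a′ \\ g) → a′ ≡ a))
      factor g gi with g ∈? i
      ... | yes g∈i = g , (g∈i , inj₁ (inverseˡ g)) , unique
        where
        \\≡ε : ∀ {a} → (a \\ g) ≡ ε → a ≡ g
        \\≡ε {a} eq = trans (sym (identityʳ a)) (trans (cong (a ∙_) (sym eq)) (\\-leftDividesˡ a g))
        unique : ∀ a → a ∈ i × Complement (a \\ g) → a ≡ g
        unique a (ai , inj₁ eq) = \\≡ε eq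
        unique a (ai , inj₂ (j , (εj , j≢i , _) , yj)) with (a \\ g) ≟ᶠ ε
        ... | yes eq = \\≡ε eq
        ... | no y≢ε = contradiction (line-unique y≢ε yj εj (∙-∈ εi (⁻¹-∈ εi ai) g∈i) εi) j≢i
      ... | no g∉i with projection g i
      ...   | a , ai , g⊥a = a , (ai , complement) , unique
        where
        y≢ε : (a \\ g) ≢ ε
        y≢ε eq = g∉i (subst (_∈ i) (trans (sym (identityʳ a)) (trans (cong (a ∙_) (sym eq)) (\\-leftDividesˡ a g))) ai)
        complement : Complement (a \\ g)
        -- The line `j` joins the cofactor to `ε`. The cofactor normalises `i` because `a` and `g`
        -- do, so `j` centralises `i`.
        complement with subst ((a \\ g) ⊥_) (inverseˡ a) (∙-⊥ˡ (a ⁻¹) g⊥a)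
        ... | j , yj , εj = inj₂ (j , (εj , j≢i , normalise⇒Commuting εi εj (j≢i ∘ sym) yj y≢ε
                (trans (^-∙ (a ⁻¹) g εi) (trans (cong ((a ⁻¹) ^_) gi) (∈⇒^≡ εi (⁻¹-∈ εi ai))))) , yj)
          where
          j≢i : j ≢ i
          j≢i refl = g∉i (subst (_∈ i) (\\-leftDividesˡ a g) (∙-∈ εi ai yj))
        unique : ∀ a′ → a′ ∈ i × Complement (a′ \\ g) → a′ ≡ a
        unique a′ (a′i , y) with a′ ≟ᶠ a
        ... | yes eq = eq
        ... | no a′≢a = contradiction (no-triangle a′≢a a′i ai g⊥a′ g⊥a) g∉i
          where
          ⊥ε : ∀ {y} → Complement y → y ⊥ ε
          ⊥ε (inj₁ refl) = i , εi , εi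
          ⊥ε (inj₂ (j , (εj , _) , yj)) = j , yj , εj
          g⊥a′ : g ⊥ a′
          g⊥a′ = subst₂ _⊥_ (\\-leftDividesˡ a′ g) (identityʳ a′) (∙-⊥ˡ a′ (⊥ε y))

    #Centralising+#Noncentralising : # Centralising? + # Noncentralising? ≡ t
    #Centralising+#Noncentralising = suc-injective (trans (cong suc (begin
      # Centralising? + # Noncentralising?
        ≡⟨ cong₂ _+_
             (#-cong Centralising? (λ j → others? j ×-dec Commuting? i j)
               (λ _ (a , b , c) → (a , b) , c) (λ _ ((a , b) , c) → a , b , c))
             (#-cong Noncentralising? (λ j → others? j ×-dec ¬? (Commuting? i j))
               (λ _ (a , b , c) → (a , b) , c) (λ _ ((a , b) , c) → a , b , c)) ⟩
      # (λ j → others? j ×-dec Commuting? i j) + # (λ j → others? j ×-dec ¬? (Commuting? i j))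
        ≡⟨ #-split others? (Commuting? i) ⟨
      # others? ∎)) (trans (sym (#-remove (ε ∈?_) i εi)) (#pencil ε)))
      where
      open ≡-Reasoning
      others? : ∀ j → Dec (ε ∈ j × j ≢ i)
      others? j = (ε ∈? j) ×-dec ¬? (j ≟ᶠ i)

    -- Conjugation by the subgroup i is semiregular on these lines.
    suc-s∣#Noncentralising : suc s ∣ # Noncentralising?
    suc-s∣#Noncentralising = #-classes Noncentralising? Orbit? (suc s)
      (λ j (εj , _) → Orbit-refl j εj) Orbit-sym Orbit-trans closed size
      where
      open Orbits (_∈? i) εi (∙-∈ εi) (⁻¹-∈ εi)
      closed : ∀ j k → ε ∈ j × j ≢ i × ¬ Commuting i j → Orbit j k → ε ∈ k × k ≢ i × ¬ Commuting i k
      closed j _ (εj , j≢i , ¬ij) (_ , h , hi , refl) = ε∈^ h εj ,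
        (λ eq → j≢i (trans (sym (^-inverse h εj eq)) (∈⇒^≡ εi (⁻¹-∈ εi hi)))) ,
        -- If the image line commuted with `i`, then h⁻¹ would fix it, so it would be `j` itself.
        λ ik → let y , yk , y≢ε = ∃≢ε (h ^ j) in
          ¬ij (subst (Commuting i) (trans (sym (commute⇒^≡ (ε∈^ h εj) yk y≢ε (ik (h ⁻¹) y (⁻¹-∈ εi hi) yk))) (^-inverse h εj refl)) ik)
      size : ∀ j → ε ∈ j × j ≢ i × ¬ Commuting i j → # (Orbit? j) ≡ suc s
      size j (εj , j≢i , ¬ij) = begin
        # (Orbit? j)                          ≡⟨ *-identityʳ _ ⟨
        # (Orbit? j) * 1                      ≡⟨ cong (# (Orbit? j) *_) (#-unique (Stabiliser? j) ε (εi , ^-identity εj) only-ε) ⟨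
        # (Orbit? j) * # (Stabiliser? j)      ≡⟨ orbit-stabiliser εj ⟨
        # (_∈? i)                             ≡⟨ #line i ⟩
        suc s                                 ∎
        where
        open ≡-Reasoning
        -- A nontrivial element of `i` fixing `j` would make `j` commute with `i`; so stabilisers
        -- are trivial and each orbit has s + 1 lines.
        only-ε : ∀ h → h ∈ i × h ^ j ≡ j → h ≡ ε
        only-ε h (hi , hj) with h ≟ᶠ ε
        ... | yes eq = eq
        ... | no h≢ε = contradiction (λ x y xi yj → sym (normalise⇒Commuting εj εi j≢i hi h≢ε hj y x yj xi)) ¬ij

  -- Contradiction with simplicity.

  Simple : Set₁
  Simple = ∀ (N : Fin np → Set) → N ε → (∀ x y → N x → N y → N (x ∙ y)) → (∀ x → N x → N (x ⁻¹)) →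
           (∀ g x → N x → N (conj g x)) → (∀ x → N x → x ≡ ε) ⊎ (∀ x → N x)

  other-line : ∀ i → ∃[ j ] (ε ∈ j × j ≢ i)
  other-line = #-avoid (ε ∈?_) (subst (1 <_) (sym (#pencil ε)) (s≤s (≤-trans (s≤s z≤n) 2≤t)))

  -- Non-identity points on two different lines through `ε`; they feed the Higman-type inequality.
  ∃noncollinear : ∃[ x ] ∃[ y ] ¬ x ⊥ y
  ∃noncollinear =
    let i , εi = line-through ε
        j , εj , j≢i = other-line i
        a , ai , a≢ε = ∃≢ε i
        b , bj , b≢ε = ∃≢ε j
    in a , b , λ a⊥b → j≢i (line-unique b≢ε bj εj (no-triangle a≢ε ai εi (⊥-sym a⊥b) (j , bj , εj)) εi)

  -- A line fixed by all conjugations is a normal subgroup, neither trivial nor everything, since it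
  -- has a further point and `ε` a further line.
  not-normal : Simple → ∀ {i} → ε ∈ i → ¬ (∀ g → g ^ i ≡ i)
  not-normal simple {i} εi normal with simple (_∈ i) εi (λ _ _ → ∙-∈ εi) (λ _ → ⁻¹-∈ εi)
                                         (λ g x xi → subst (conj g x ∈_) (normal g) (conj-∈ g xi))
  ... | inj₁ trivial = let x , xi , x≢ε = ∃≢ε i in x≢ε (trivial x xi)
  ... | inj₂ whole = let j , εj , j≢i = other-line i
                         x , xj , x≢ε = ∃≢ε j
                     in j≢i (line-unique x≢ε xj εj (whole x) εi)

  open Orbits {S = λ _ → ⊤} (λ _ → yes tt) tt (λ _ _ → tt) (λ _ → tt)

  -- Orbit-stabiliser for the whole group: both the group order and the normaliser order carry a
  -- factor s + 1, which cancels.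
  orbit-size : ∀ {i} (εi : ε ∈ i) → # (Orbit? i) * suc (# (Centralising? i εi) * s) ≡ suc (t * s)
  orbit-size {i} εi = *-cancelˡ-≡ _ _ (suc s) (begin
    suc s * (# (Orbit? i) * suc (# (Centralising? i εi) * s))   ≡⟨ *-comm (suc s) _ ⟩
    # (Orbit? i) * suc (# (Centralising? i εi) * s) * suc s     ≡⟨ *-assoc (# (Orbit? i)) _ (suc s) ⟩
    # (Orbit? i) * (suc (# (Centralising? i εi) * s) * suc s)   ≡⟨ cong (# (Orbit? i) *_) (*-comm _ (suc s)) ⟩
    # (Orbit? i) * (suc s * suc (# (Centralising? i εi) * s))   ≡⟨ cong (# (Orbit? i) *_) (#normaliser i εi) ⟨
    # (Orbit? i) * # (λ g → (g ^ i) ≟ᶠ i)                       ≡⟨ cong (# (Orbit? i) *_)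
                                                                     (#-cong (λ g → (g ^ i) ≟ᶠ i) (Stabiliser? i) (λ _ → tt ,_) (λ _ → proj₂)) ⟩
    # (Orbit? i) * # (Stabiliser? i)                            ≡⟨ orbit-stabiliser εi ⟨
    # {np} (λ _ → yes tt)                                       ≡⟨ #-all np ⟩
    np                                                          ≡⟨ #points ε ⟩
    suc s * suc (t * s)                                         ∎)
    where open ≡-Reasoning

  #Centralising≡1 : Simple → ∀ {i} (εi : ε ∈ i) → # (Centralising? i εi) ≡ 1
  #Centralising≡1 simple {i} εi = centraliser-count 2≤s 2≤t (orbit-size εi) 1<orbit
    (subst (# (Orbit? i) ≤_) (#pencil ε) (#-mono (Orbit? i) (ε ∈?_) λ { _ (_ , g , _ , refl) → ε∈^ g εi }))
    (#Centralising+#Noncentralising i εi) (suc-s∣#Noncentralising i εi)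
    (let _ , _ , x≁y = ∃noncollinear in Higman.higman x≁y (≤-trans (s≤s z≤n) 2≤s))
    where
    -- Since `i` is not normal, some g moves it, and `i` and `g ^ i` are two members of the class.
    1<orbit : 1 < # (Orbit? i)
    1<orbit = let g , gi≢i = ¬∀⟶∃¬ np _ (λ g → (g ^ i) ≟ᶠ i) (not-normal simple εi) in
      1<# (Orbit? i) (Orbit-refl i εi) (εi , g , tt , refl) (gi≢i ∘ sym)

  not-simple : ¬ Simple
  not-simple simple = orbit-size-∤ 2≤s 2≤t (orbit-eq εi) (subst (# (Orbit? i) ∣_) (#pencil ε)
    (#-classes (ε ∈?_) Orbit? (# (Orbit? i)) Orbit-refl Orbit-sym Orbit-trans
      (λ { _ _ εj (_ , g , _ , refl) → ε∈^ g εj })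
      -- Every line has one centralising line, so all class sizes solve the same equation and agree.
      (λ j εj → *-cancelʳ-≡ _ _ (suc (1 * s)) (trans (orbit-eq εj) (sym (orbit-eq εi))))))
    where
    i = proj₁ (line-through ε)
    εi = proj₂ (line-through ε)
    orbit-eq : ∀ {j} → ε ∈ j → # (Orbit? j) * suc (1 * s) ≡ suc (t * s)
    orbit-eq {j} εj = subst (λ c → # (Orbit? j) * suc (c * s) ≡ suc (t * s)) (#Centralising≡1 simple εj) (orbit-size εj)

-- Transport of the simple group to the points.

pt-· : ∀ {np nl} (g h : PMap np nl) x → pt (g · h) x ≡ pt g (pt h x)
pt-· g h x = lookup∘tabulate (λ i → pt g (pt h i)) x

module _ (T : Group 0ℓ 0ℓ) where

  open Group T using (Carrier; _≈_; _∙_; ε; _⁻¹; _//_; ∙-cong; ∙-congˡ; ∙-congʳ; ⁻¹-cong; assoc;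
                      identityˡ; identityʳ; inverseˡ; inverseʳ)
               renaming (refl to ≈-refl; sym to ≈-sym; trans to ≈-trans)
  open GroupProperties T using (⁻¹-involutive; //-rightDividesˡ)

  module Transport {np nl}
    (φ : Carrier × Carrier → PMap np nl)
    (φ-cong : ∀ a b c d → a ≈ c → b ≈ d → φ (a , b) ≡ φ (c , d))
    (φ-homo : ∀ a b c d → φ (a ∙ c , b ∙ d) ≡ φ (a , b) · φ (c , d))
    (φ-injective : ∀ a b c d → φ (a , b) ≡ φ (c , d) → a ≈ c × b ≈ d)
    {N : Subset np nl} (N-image : ∀ g → g ∈ˢ N ⇔ (∃[ a ] φ (a , ε) ≡ g)) (N-regular : IsRegular N)
    (o : Fin np) (o-stabiliser : ∀ a b → (pt (φ (a , b)) o ≡ o) ⇔ (a ≈ b))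
    where

    -- The orbit map of the base point under the regular factor, with inverse `element`.
    point : Carrier → Fin np
    point a = pt (φ (a , ε)) o

    point-cong : ∀ {a b} → a ≈ b → point a ≡ point b
    point-cong {a} {b} a≈b = cong (λ g → pt g o) (φ-cong a ε b ε a≈b (≈-refl))

    element : Fin np → Carrier
    element x = let g , g∈N , _ = proj₁ N-regular o x in proj₁ (Equivalence.to (N-image g) g∈N)

    point-element : ∀ x → point (element x) ≡ x
    point-element x = let g , g∈N , gx = proj₁ N-regular o x in
      trans (cong (λ h → pt h o) (proj₂ (Equivalence.to (N-image g) g∈N))) gx

    element-point : ∀ a → element (point a) ≈ a
    element-point a = proj₁ (φ-injective _ ε a ε (proj₂ N-regular _ _ o
      (Equivalence.from (N-image _) (_ , refl)) (Equivalence.from (N-image _) (a , refl)) (point-element (point a))))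

    -- Factor (a, b) as (ab⁻¹, ε)(b, b); the diagonal part fixes `o`.
    pt-φ-o : ∀ a b → pt (φ (a , b)) o ≡ point (a // b)
    pt-φ-o a b = begin
      pt (φ (a , b)) o                            ≡⟨ cong (λ g → pt g o) (φ-cong _ _ _ _ (//-rightDividesˡ b a) (identityˡ b)) ⟨
      pt (φ ((a // b) ∙ b , ε ∙ b)) o             ≡⟨ cong (λ g → pt g o) (φ-homo (a // b) ε b b) ⟩
      pt (φ (a // b , ε) · φ (b , b)) o           ≡⟨ pt-· (φ (a // b , ε)) (φ (b , b)) o ⟩
      pt (φ (a // b , ε)) (pt (φ (b , b)) o)      ≡⟨ cong (pt (φ (a // b , ε))) (Equivalence.from (o-stabiliser b b) (≈-refl)) ⟩
      point (a // b)                              ∎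
      where open ≡-Reasoning

    -- Under `point`, the pair (a, b) acts as c ↦ acb⁻¹, which is the source of two-sided
    -- invariance.
    pt-φ : ∀ a b c → pt (φ (a , b)) (point c) ≡ point ((a ∙ c) // b)
    pt-φ a b c = begin
      pt (φ (a , b)) (pt (φ (c , ε)) o)   ≡⟨ pt-· (φ (a , b)) (φ (c , ε)) o ⟨
      pt (φ (a , b) · φ (c , ε)) o        ≡⟨ cong (λ g → pt g o) (φ-homo a b c ε) ⟨
      pt (φ (a ∙ c , b ∙ ε)) o            ≡⟨ cong (λ g → pt g o) (φ-cong _ _ _ _ (≈-refl) (identityʳ b)) ⟩
      pt (φ (a ∙ c , b)) o                ≡⟨ pt-φ-o (a ∙ c) b ⟩
      point ((a ∙ c) // b)                ∎
      where open ≡-Reasoning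

    infixl 7 _∘ₚ_

    -- Working on points replaces the setoid equality of `T` by propositional equality on a finite
    -- type, where elements can be counted and properties decided.
    _∘ₚ_ : Fin np → Fin np → Fin np
    x ∘ₚ y = point (element x ∙ element y)

    εₚ : Fin np
    εₚ = point ε

    _⁻¹ₚ : Fin np → Fin np
    x ⁻¹ₚ = point (element x ⁻¹)

    point-∙ : ∀ a b → point a ∘ₚ point b ≡ point (a ∙ b)
    point-∙ a b = point-cong (∙-cong (element-point a) (element-point b))

    point-⁻¹ : ∀ a → (point a) ⁻¹ₚ ≡ point (a ⁻¹)
    point-⁻¹ a = point-cong (⁻¹-cong (element-point a))

    isGroupₚ : IsGroup _≡_ _∘ₚ_ εₚ _⁻¹ₚ
    isGroupₚ = record
      { isMonoid = record
        { isSemigroup = record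
          { isMagma = record { isEquivalence = isEquivalence ; ∙-cong = cong₂ _∘ₚ_ }
          ; assoc = λ x y z → point-cong (≈-trans (∙-congʳ (element-point _))
                      (≈-trans (assoc _ _ _) (∙-congˡ (≈-sym (element-point _)))))
          }
        ; identity = (λ x → trans (point-cong (≈-trans (∙-congʳ (element-point ε)) (identityˡ _))) (point-element x))
                   , (λ x → trans (point-cong (≈-trans (∙-congˡ (element-point ε)) (identityʳ _))) (point-element x))
        }
      ; inverse = (λ x → point-cong (≈-trans (∙-congʳ (element-point _)) (inverseˡ _)))
                , (λ x → point-cong (≈-trans (∙-congˡ (element-point _)) (inverseʳ _)))
      ; ⁻¹-cong = cong _⁻¹ₚ
      }

    -- The line map accompanying x ↦ axb; the inverse compensates for the one in the action of the
    -- second factor.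
    translateₚ : Fin np → Fin np → Fin nl → Fin nl
    translateₚ a b = ln (φ (element a , element b ⁻¹))

    pt-translate : ∀ a b x → pt (φ (element a , element b ⁻¹)) x ≡ (a ∘ₚ x) ∘ₚ b
    pt-translate a b x = begin
      pt (φ (element a , element b ⁻¹)) x                       ≡⟨ cong (pt (φ (element a , element b ⁻¹))) (point-element x) ⟨
      pt (φ (element a , element b ⁻¹)) (point (element x))     ≡⟨ pt-φ (element a) (element b ⁻¹) (element x) ⟩
      point ((element a ∙ element x) // (element b ⁻¹))         ≡⟨ point-cong (∙-cong (≈-sym (element-point _)) (⁻¹-involutive (element b))) ⟩
      (a ∘ₚ x) ∘ₚ b                                             ∎
      where open ≡-Reasoning

    -- Simplicity of `T` is applied to the preimage of `M` under `point`.
    simpleₚ : IsSimpleGroup T → ∀ (M : Fin np → Set) → M εₚ → (∀ x y → M x → M y → M (x ∘ₚ y)) →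
      (∀ x → M x → M (x ⁻¹ₚ)) → (∀ g x → M x → M ((g ∘ₚ x) ∘ₚ (g ⁻¹ₚ))) →
      (∀ x → M x → x ≡ εₚ) ⊎ (∀ x → M x)
    simpleₚ (_ , simple) M M-ε M-∙ M-⁻¹ M-conj with simple (M ∘ point)
      ( (λ a≈b → subst M (point-cong a≈b)) , M-ε
      , (λ a b Ma Mb → subst M (point-∙ a b) (M-∙ _ _ Ma Mb))
      , (λ a Ma → subst M (point-⁻¹ a) (M-⁻¹ _ Ma))
      , (λ g a Ma → subst M (trans (cong₂ _∘ₚ_ (point-∙ g a) (point-⁻¹ g)) (point-∙ (g ∙ a) (g ⁻¹))) (M-conj (point g) (point a) Ma)))
    ... | inj₁ trivial = inj₁ λ x Mx → trans (sym (point-element x)) (point-cong (trivial _ (subst M (sym (point-element x)) Mx)))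
    ... | inj₂ whole = inj₂ λ x → subst M (point-element x) (whole (element x))

theorem4p1 : ∀ (np nl : ℕ) (inc : Incidence np nl) → IsThickGQ inc →
    (G : Subset np nl) → IsAutGroup inc G → IsPrimitive G →
    ¬ IsTypeHS G
theorem4p1 np nl inc (s , t , 2≤s , 2≤t , gq) G ((_ , G-·) , G-aut) _
  (T , _ , simple , φ , N₁ , N₂ , φ-cong , φ-homo , φ-injective , _ , N₁-image , N₂-image ,
   N₁-minimal , N₂-minimal , N₁-regular , _ , o , o-stabiliser) =
  TwoSidedAction.not-simple inc gq 2≤s 2≤t isGroupₚ translateₚ translate-inc (simpleₚ simple)
  where
  open Group T using (ε; identityˡ; identityʳ)
  open Transport T φ φ-cong φ-homo φ-injective N₁-image N₁-regular o o-stabiliser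
  -- (a, b) = (a, ε)(ε, b), a product of elements of the two minimal normal subgroups, both
  -- contained in `G`.
  φ∈G : ∀ a b → φ (a , b) ∈ˢ G
  φ∈G a b = subst (_∈ˢ G) (trans (sym (φ-homo a ε ε b)) (φ-cong _ _ _ _ (identityʳ a) (identityˡ b)))
    (G-· _ _ (proj₁ (proj₂ (proj₁ N₁-minimal)) _ (Equivalence.from (N₁-image _) (a , refl)))
             (proj₁ (proj₂ (proj₁ N₂-minimal)) _ (Equivalence.from (N₂-image _) (b , refl))))
  -- `φ` at these arguments is an automorphism whose point map is x ↦ axb.
  translate-inc : ∀ a b {x l} → inc x l ≡ inc ((a ∘ₚ x) ∘ₚ b) (translateₚ a b l)
  translate-inc a b {x} {l} = trans (sym (proj₂ (proj₂ (G-aut _ (φ∈G _ _))) x l))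
    (cong (λ y → inc y (translateₚ a b l)) (pt-translate a b x))
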